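{- For every $n\geq 1$, $$\max_{w\in B_n}\left\lvert O_{\mathtt s_B}(w)\right\rvert=n+1,$$ where $O_{\mathtt s_B}(w)=\{w,\mathtt s_B(w),\mathtt s_B^2(w),\ldots\}$ is the forward orbit of $w$ under the type-$B$ stack-sorting map $\mathtt s_B:B_n\to B_n$.
   Context: The hyperoctahedral group $B_n$ is the subgroup of $S_{2n}$ consisting of the permutations $w$ with $w(2n+1-i)=2n+1-w(i)$ for all $i\in[2n]$. With $s_i=(i\;\,i+1)\in S_{2n}$, its simple generators are $s_i^B=s_is_{2n-i}$ for $1\le i\le n-1$ and $s_n^B=s_n$. Products are compositions of functions. The left weak order on a Coxeter group is $x\leq_L y\iff \ell(yx^{ -1})=\ell(y)-\ell(x)$, with $\ell$ the Coxeter length; $(B_n,\leq_L)$ is a sublattice of $(S_{2n},\leq_L)$. Type-$B$ sylvester congruence. For $w\in B_n$ and positions $1\le i<j\le 2n$, say $i$ and $j$ are separated in $w$ if there is $k$ with $i<k<j$ such that either ($k\le n$ and $w(k)<\min\{w(i),w(j)\}$) or ($k\ge n+1$ and $w(k)>\max\{w(i),w(j)\}$). Define a partial order $\preceq_w$ on $[2n]$: distinct positions $i,j$ are incomparable if and only if they are separated, and otherwise the position with the smaller value of $w$ is below the other. (This is the partial order of the permutree of $w$ in which positions $1,\ldots,n$ emit upward walls and positions $n+1,\ldots,2n$ emit downward walls.) The type-$B$ sylvester congruence on $B_n$ is the relation $v\equiv w \iff {\preceq_v}={\preceq_w}$; it is a lattice congruence on $(B_n,\leq_L)$ in which $\{e\}$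 is a class. Each class has a unique $\leq_L$-minimal element, and $\pi_\downarrow(w)$ denotes the minimal element of the class of $w$. The type-$B$ stack-sorting map is $\mathtt s_B(w)=w\,(\pi_\downarrow(w))^{ -1}$. -}

module Defs where

open import Data.Nat.Base using (ℕ; zero; suc; _+_; _*_; _∸_; _⊓_; _⊔_; _≤_; _<_; z≤n; s≤s)
import Data.Nat.Properties as ℕ
open import Data.Nat.GeneralisedArithmetic using (iterate)
open import Data.Fin.Base using (Fin; zero; suc; toℕ; fromℕ<; opposite; _↑ˡ_)
import Data.Fin.Properties as Fin
open import Data.Fin.Permutation as Perm
  using (Permutation′; _⟨$⟩ʳ_; _⟨$⟩ˡ_; _∘ₚ_; flip; transpose; inverseˡ; inverseʳ)
open import Data.Product.Base using (∃; _×_; _,_; proj₁; proj₂)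
open import Data.Sum.Base using (_⊎_; inj₁; inj₂)
open import Data.Vec.Base using (Vec; []; _∷_; _∷ʳ_; tabulate)
open import Data.Vec.Relation.Binary.Lex.Strict using (Lex-<; this; next; <-wellFounded)
open import Data.Nat.Induction using () renaming (<-wellFounded to ℕ-<-wellFounded)
open import Function.Base using (_∘_)
open import Function.Bundles using (Bijection; Equivalence; _⇔_; mk⇔)
open import Induction.WellFounded using (Acc; acc)
open import Level using (0ℓ)
open import Relation.Binary.Bundles using (Setoid)
open import Relation.Binary.PropositionalEquality
open import Relation.Nullary.Decidable
  using (Dec; yes; no; map′; _×-dec_; _⊎-dec_; _→-dec_; ¬?; dec-true; dec-false)
open import Relation.Nullary.Negation.Core using (¬_; contradiction)

-- Positions and values are 0-indexed, so that i ↦ 2n+1-i is `opposite`,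
-- and the positions 1,…,n of [2n] are the k with toℕ k < n.

record B (n : ℕ) : Set where
  constructor mkB
  field
    perm : Permutation′ (2 * n)
    symm : ∀ i → perm ⟨$⟩ʳ opposite i ≡ opposite (perm ⟨$⟩ʳ i)

open B public

infix  4 _≈_ _≈?_ _≤L_ _≡ᴮ_
infixl 7 _∙_
infix  10 _⁻¹
infixl 9 _·_

_·_ : ∀ {n} → B n → Fin (2 * n) → Fin (2 * n)
w · i = perm w ⟨$⟩ʳ i

_≈_ : ∀ {n} → B n → B n → Set
v ≈ w = ∀ i → v · i ≡ w · i

ε : ∀ {n} → B n
ε = mkB Perm.id (λ _ → refl)

-- `_∘ₚ_` applies its left argument first.
_∙_ : ∀ {n} → B n → B n → B n
v ∙ w = mkB (perm w ∘ₚ perm v) (λ i → trans (cong (v ·_) (symm w i)) (symm v (w · i)))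

_⁻¹ : ∀ {n} → B n → B n
w ⁻¹ = mkB (flip (perm w)) λ i → begin
  perm w ⟨$⟩ˡ opposite i                          ≡⟨ cong (λ x → perm w ⟨$⟩ˡ opposite x) (inverseʳ (perm w)) ⟨
  perm w ⟨$⟩ˡ opposite (w · (perm w ⟨$⟩ˡ i))      ≡⟨ cong (perm w ⟨$⟩ˡ_) (symm w _) ⟨
  perm w ⟨$⟩ˡ (w · (opposite (perm w ⟨$⟩ˡ i)))    ≡⟨ inverseˡ (perm w) ⟩
  opposite (perm w ⟨$⟩ˡ i)                        ∎
  where open ≡-Reasoning

module _ {m : ℕ} where

  transpose-left : (i j : Fin m) → transpose i j ⟨$⟩ʳ i ≡ j
  transpose-left i j rewrite dec-true (i Fin.≟ i) refl = refl

  transpose-right : (i j : Fin m) → transpose i j ⟨$⟩ʳ j ≡ i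
  transpose-right i j with j Fin.≟ i
  ... | yes refl = refl
  ... | no  _    rewrite dec-true (j Fin.≟ j) refl = refl

  transpose-fix : {i j k : Fin m} → k ≢ i → k ≢ j → transpose i j ⟨$⟩ʳ k ≡ k
  transpose-fix {i} {j} {k} k≢i k≢j
    rewrite dec-false (k Fin.≟ i) k≢i | dec-false (k Fin.≟ j) k≢j = refl

  transpose-comm : (i j k : Fin m) → transpose i j ⟨$⟩ʳ k ≡ transpose j i ⟨$⟩ʳ k
  transpose-comm i j k = go (k Fin.≟ i) (k Fin.≟ j)
    where
    go : Dec (k ≡ i) → Dec (k ≡ j) → transpose i j ⟨$⟩ʳ k ≡ transpose j i ⟨$⟩ʳ k
    go (yes refl) _          = trans (transpose-left k j) (sym (transpose-right j k))
    go (no _)     (yes refl) = trans (transpose-right i k) (sym (transpose-left k i))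
    go (no k≢i)   (no k≢j)   = trans (transpose-fix k≢i k≢j) (sym (transpose-fix k≢j k≢i))

  transpose-conj : (f : Fin m → Fin m) → (∀ {x y} → f x ≡ f y → x ≡ y) → ∀ i j k →
                   f (transpose i j ⟨$⟩ʳ k) ≡ transpose (f i) (f j) ⟨$⟩ʳ f k
  transpose-conj f inj i j k = go (k Fin.≟ i) (k Fin.≟ j)
    where
    go : Dec (k ≡ i) → Dec (k ≡ j) → f (transpose i j ⟨$⟩ʳ k) ≡ transpose (f i) (f j) ⟨$⟩ʳ f k
    go (yes refl) _          = trans (cong f (transpose-left k j)) (sym (transpose-left (f k) (f j)))
    go (no _)     (yes refl) = trans (cong f (transpose-right i k)) (sym (transpose-right (f i) (f k)))
    go (no k≢i)   (no k≢j)   = trans (cong f (transpose-fix k≢i k≢j))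
                                     (sym (transpose-fix (k≢i ∘ inj) (k≢j ∘ inj)))

  opposite-injective : {x y : Fin m} → opposite x ≡ opposite y → x ≡ y
  opposite-injective {x} {y} eq = begin
    x                     ≡⟨ Fin.opposite-involutive x ⟨
    opposite (opposite x) ≡⟨ cong opposite eq ⟩
    opposite (opposite y) ≡⟨ Fin.opposite-involutive y ⟩
    y                     ∎
    where open ≡-Reasoning

  opposite-sum : (x : Fin m) → toℕ (opposite x) + suc (toℕ x) ≡ m
  opposite-sum x = trans (cong (_+ suc (toℕ x)) (Fin.opposite-prop x)) (ℕ.m∸n+n≡m (Fin.toℕ<n x))

  opposite-cancel-< : {x y : Fin m} → toℕ (opposite x) < toℕ (opposite y) → toℕ y < toℕ x
  opposite-cancel-< {x} {y} lt = ℕ.≰⇒> λ x≤y → ℕ.<-irrefl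
    (trans (opposite-sum x) (sym (opposite-sum y)))
    (ℕ.+-mono-<-≤ lt (s≤s x≤y))

  opposite-cancel-≤ : {x y : Fin m} → toℕ (opposite x) ≤ toℕ (opposite y) → toℕ y ≤ toℕ x
  opposite-cancel-≤ {x} {y} le = ℕ.≮⇒≥ λ x<y → ℕ.<-irrefl
    (trans (opposite-sum x) (sym (opposite-sum y)))
    (ℕ.+-mono-≤-< le (s≤s x<y))

module _ {n : ℕ} where

  left : Fin n → Fin (2 * n)
  left i = i ↑ˡ (n + 0)

  n+n≡2*n : n + n ≡ 2 * n
  n+n≡2*n = cong (n +_) (sym (ℕ.+-identityʳ n))

  right-bound : (i : Fin n) → suc (toℕ i) < 2 * n
  right-bound i = ℕ.≤-trans (ℕ.+-mono-≤ (ℕ.≤-<-trans z≤n (Fin.toℕ<n i)) (Fin.toℕ<n i))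
                            (ℕ.≤-reflexive n+n≡2*n)

  right : Fin n → Fin (2 * n)
  right i = fromℕ< (right-bound i)

  toℕ-left : (i : Fin n) → toℕ (left i) ≡ toℕ i
  toℕ-left i = Fin.toℕ-↑ˡ i (n + 0)

  toℕ-right : (i : Fin n) → toℕ (right i) ≡ suc (toℕ i)
  toℕ-right i = Fin.toℕ-fromℕ< (right-bound i)

  opposite-< : {x : Fin (2 * n)} → toℕ x < n → n ≤ toℕ (opposite x)
  opposite-< {x} x<n = ℕ.+-cancelʳ-≤ (suc (toℕ x)) n (toℕ (opposite x)) (begin
    n + suc (toℕ x)                ≤⟨ ℕ.+-monoʳ-≤ n x<n ⟩
    n + n                          ≡⟨ n+n≡2*n ⟩
    2 * n                          ≡⟨ opposite-sum x ⟨
    toℕ (opposite x) + suc (toℕ x) ∎)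
    where open ℕ.≤-Reasoning

  <n⇒≢opposite : {x y : Fin (2 * n)} → toℕ x < n → toℕ y < n → x ≢ opposite y
  <n⇒≢opposite x<n y<n refl = ℕ.<⇒≱ x<n (opposite-< y<n)

  left<n : (i : Fin n) → toℕ (left i) < n
  left<n i = subst (_< n) (sym (toℕ-left i)) (Fin.toℕ<n i)

  right<n : (i : Fin n) → suc (toℕ i) < n → toℕ (right i) < n
  right<n i lt = subst (_< n) (sym (toℕ-right i)) lt

  right-last : (i : Fin n) → ¬ (suc (toℕ i) < n) → opposite (left i) ≡ right i
  right-last i i≮ = Fin.toℕ-injective (ℕ.+-cancelʳ-≡ (suc (toℕ (left i))) _ _ (begin
    toℕ (opposite (left i)) + suc (toℕ (left i)) ≡⟨ opposite-sum (left i) ⟩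
    2 * n                                        ≡⟨ n+n≡2*n ⟨
    n + n                                        ≡⟨ cong₂ _+_ (sym i+1≡n) (sym i+1≡n) ⟩
    suc (toℕ i) + suc (toℕ i)                    ≡⟨ cong₂ _+_ (toℕ-right i) (cong suc (toℕ-left i)) ⟨
    toℕ (right i) + suc (toℕ (left i))           ∎))
    where
    open ≡-Reasoning
    i+1≡n : suc (toℕ i) ≡ n
    i+1≡n = ℕ.≤-antisym (Fin.toℕ<n i) (ℕ.≮⇒≥ i≮)

  adjacent mirror : Fin n → Permutation′ (2 * n)
  adjacent i = transpose (left i) (right i)
  mirror   i = transpose (opposite (left i)) (opposite (right i))

  opposite-adjacent : ∀ i k → opposite (adjacent i ⟨$⟩ʳ k) ≡ mirror i ⟨$⟩ʳ opposite k
  opposite-adjacent i = transpose-conj opposite opposite-injective (left i) (right i)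

  opposite-mirror : ∀ i k → opposite (mirror i ⟨$⟩ʳ k) ≡ adjacent i ⟨$⟩ʳ opposite k
  opposite-mirror i k = trans
    (transpose-conj opposite opposite-injective (opposite (left i)) (opposite (right i)) k)
    (cong₂ (λ x y → transpose x y ⟨$⟩ʳ opposite k)
      (Fin.opposite-involutive (left i)) (Fin.opposite-involutive (right i)))

  mirror-fix : ∀ i → suc (toℕ i) < n → ∀ {k} → toℕ k < n → mirror i ⟨$⟩ʳ k ≡ k
  mirror-fix i lt k<n = transpose-fix (<n⇒≢opposite k<n (left<n i)) (<n⇒≢opposite k<n (right<n i lt))

  adjacent-mirror-comm : ∀ i → suc (toℕ i) < n → ∀ k →
    adjacent i ⟨$⟩ʳ (mirror i ⟨$⟩ʳ k) ≡ mirror i ⟨$⟩ʳ (adjacent i ⟨$⟩ʳ k)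
  adjacent-mirror-comm i lt k = sym (trans
    (transpose-conj (mirror i ⟨$⟩ʳ_)
       (λ eq → trans (sym (inverseˡ (mirror i))) (trans (cong (mirror i ⟨$⟩ˡ_) eq) (inverseˡ (mirror i))))
       (left i) (right i) k)
    (cong₂ (λ x y → transpose x y ⟨$⟩ʳ (mirror i ⟨$⟩ʳ k))
       (mirror-fix i lt (left<n i)) (mirror-fix i lt (right<n i lt))))

  -- In 1-indexed terms gen i is the generator s^B_{i+1}: s_{i+1} s_{2n-i-1}
  -- when i+1 < n, with s_{2n-i-1} the conjugate of s_{i+1} by k ↦ 2n+1-k, and
  -- s_n when i+1 = n.
  gen : Fin n → B n
  gen i with suc (toℕ i) ℕ.<? n
  ... | yes lt = mkB (mirror i ∘ₚ adjacent i) λ k → begin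
    adjacent i ⟨$⟩ʳ (mirror i ⟨$⟩ʳ opposite k)   ≡⟨ cong (adjacent i ⟨$⟩ʳ_) (opposite-adjacent i k) ⟨
    adjacent i ⟨$⟩ʳ opposite (adjacent i ⟨$⟩ʳ k) ≡⟨ opposite-mirror i _ ⟨
    opposite (mirror i ⟨$⟩ʳ (adjacent i ⟨$⟩ʳ k)) ≡⟨ cong opposite (adjacent-mirror-comm i lt k) ⟨
    opposite (adjacent i ⟨$⟩ʳ (mirror i ⟨$⟩ʳ k)) ∎
    where open ≡-Reasoning
  ... | no i≮ = mkB (adjacent i) λ k → begin
    adjacent i ⟨$⟩ʳ opposite k                       ≡⟨ transpose-comm (left i) (right i) (opposite k) ⟩
    transpose (right i) (left i) ⟨$⟩ʳ opposite k     ≡⟨ cong₂ (λ x y → transpose x y ⟨$⟩ʳ opposite k)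
                                                          (sym (right-last i i≮)) left≡ ⟩
    mirror i ⟨$⟩ʳ opposite k                         ≡⟨ opposite-adjacent i k ⟨
    opposite (adjacent i ⟨$⟩ʳ k)                     ∎
    where
    open ≡-Reasoning
    left≡ : left i ≡ opposite (right i)
    left≡ = trans (sym (Fin.opposite-involutive (left i))) (cong opposite (right-last i i≮))

  adjacent-fix : ∀ i {k} → toℕ k < toℕ i → adjacent i ⟨$⟩ʳ k ≡ k
  adjacent-fix i {k} k<i = transpose-fix
    (λ { refl → ℕ.<-irrefl (toℕ-left i) k<i })
    (λ { refl → ℕ.<-asym k<i (ℕ.≤-reflexive (sym (toℕ-right i))) })

  gen-fix : ∀ i {k} → toℕ k < toℕ i → gen i · k ≡ k
  gen-fix i {k} k<i with suc (toℕ i) ℕ.<? n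
  ... | yes lt = trans (cong (adjacent i ⟨$⟩ʳ_) (mirror-fix i lt (ℕ.<-trans k<i (Fin.toℕ<n i))))
                       (adjacent-fix i k<i)
  ... | no  _  = adjacent-fix i k<i

  gen-right : ∀ i → gen i · right i ≡ left i
  gen-right i with suc (toℕ i) ℕ.<? n
  ... | yes lt = trans (cong (adjacent i ⟨$⟩ʳ_) (mirror-fix i lt (right<n i lt)))
                       (transpose-right (left i) (right i))
  ... | no  _  = transpose-right (left i) (right i)

Word : ℕ → ℕ → Set
Word n k = Vec (Fin n) k

eval : ∀ {n k} → Word n k → B n
eval []      = ε
eval (i ∷ u) = gen i ∙ eval u

eval-∷ʳ : ∀ {n k} (u : Word n k) a → eval (u ∷ʳ a) ≈ eval u ∙ gen a
eval-∷ʳ []      a x = refl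
eval-∷ʳ (i ∷ u) a x = cong (gen i ·_) (eval-∷ʳ u a x)

HasWord : ∀ {n} → B n → ℕ → Set
HasWord {n} w k = ∃ λ (u : Word n k) → eval u ≈ w

module _ {n : ℕ} where

  ·-injective : (w : B n) → ∀ {x y} → w · x ≡ w · y → x ≡ y
  ·-injective w {x} {y} eq = trans (sym (inverseˡ (perm w)))
                               (trans (cong (perm w ⟨$⟩ˡ_) eq) (inverseˡ (perm w)))

  Descent : B n → Fin n → Set
  Descent w i = toℕ (w · right i) < toℕ (w · left i)

  module _ (w : B n) (noDescent : ∀ i → ¬ Descent w i) where

    ascent : ∀ {p q} → toℕ q ≡ suc (toℕ p) → toℕ p < n → toℕ (w · p) < toℕ (w · q)
    ascent {p} {q} q≡p+1 p<n = ℕ.≤∧≢⇒<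
      (subst₂ (λ x y → toℕ (w · x) ≤ toℕ (w · y)) p≡ q≡ (ℕ.≮⇒≥ (noDescent i)))
      λ eq → ℕ.<-irrefl (trans (cong toℕ (·-injective w (Fin.toℕ-injective eq))) q≡p+1) (ℕ.n<1+n _)
      where
      i = fromℕ< p<n
      p≡ : left i ≡ p
      p≡ = Fin.toℕ-injective (trans (toℕ-left i) (Fin.toℕ-fromℕ< p<n))
      q≡ : right i ≡ q
      q≡ = Fin.toℕ-injective (trans (toℕ-right i) (trans (cong suc (Fin.toℕ-fromℕ< p<n)) (sym q≡p+1)))

    opposite-adj : ∀ {p q : Fin (2 * n)} → toℕ q ≡ suc (toℕ p) →
                   toℕ (opposite p) ≡ suc (toℕ (opposite q))
    opposite-adj {p} {q} q≡p+1 = ℕ.+-cancelʳ-≡ (suc (toℕ p)) _ _ (begin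
      toℕ (opposite p) + suc (toℕ p)       ≡⟨ opposite-sum p ⟩
      2 * n                                ≡⟨ opposite-sum q ⟨
      toℕ (opposite q) + suc (toℕ q)       ≡⟨ cong (λ z → toℕ (opposite q) + suc z) q≡p+1 ⟩
      toℕ (opposite q) + suc (suc (toℕ p)) ≡⟨ ℕ.+-suc _ _ ⟩
      suc (toℕ (opposite q)) + suc (toℕ p) ∎)
      where open ≡-Reasoning

    ascent′ : ∀ {p q} → toℕ q ≡ suc (toℕ p) → toℕ (w · p) < toℕ (w · q)
    ascent′ {p} {q} q≡p+1 with toℕ p ℕ.<? n
    ... | yes p<n = ascent q≡p+1 p<n
    ... | no  p≮n = opposite-cancel-<
      (subst₂ (λ x y → toℕ x < toℕ y) (symm w q) (symm w p) (ascent (opposite-adj q≡p+1) q′<n))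
      where
      q′<n : toℕ (opposite q) < n
      q′<n = ℕ.≰⇒> λ n≤q′ → ℕ.<-irrefl (trans (n+n≡2*n {n}) (sym (opposite-sum q)))
        (ℕ.+-mono-≤-< n≤q′ (s≤s (subst (n ≤_) (sym q≡p+1) (ℕ.m≤n⇒m≤1+n (ℕ.≮⇒≥ p≮n)))))

    expanding : ∀ t {i} → toℕ i ≡ t → t ≤ toℕ (w · i)
    expanding zero    _  = z≤n
    expanding (suc t) {i} eq = ℕ.≤-<-trans (expanding t toℕp) (ascent′ (trans eq (cong suc (sym toℕp))))
      where
      t<2n : t < 2 * n
      t<2n = ℕ.<-trans (ℕ.n<1+n t) (subst (_< 2 * n) eq (Fin.toℕ<n i))
      toℕp : toℕ (fromℕ< t<2n) ≡ t
      toℕp = Fin.toℕ-fromℕ< t<2n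

    noDescent⇒ε : ε ≈ w
    noDescent⇒ε i = Fin.toℕ-injective (ℕ.≤-antisym (expanding _ refl)
      (opposite-cancel-≤ (subst (λ x → toℕ (opposite i) ≤ toℕ x) (symm w i) (expanding _ refl))))

  -- Sorting: undoing a descent in positions 1,…,n+1 makes the one-line
  -- notation lexicographically smaller.

  oneLine : B n → Vec ℕ (2 * n)
  oneLine w = tabulate (λ i → toℕ (w · i))

  _<ₗₑₓ_ : ∀ {m} → Vec ℕ m → Vec ℕ m → Set
  _<ₗₑₓ_ = Lex-< _≡_ _<_

  tabulate-<ₗₑₓ : ∀ {m} {f g : Fin m → ℕ} i → (∀ k → toℕ k < toℕ i → f k ≡ g k) → f i < g i →
                  tabulate f <ₗₑₓ tabulate g
  tabulate-<ₗₑₓ zero    eq lt = this lt refl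
  tabulate-<ₗₑₓ (suc i) eq lt = next (eq zero (s≤s z≤n)) (tabulate-<ₗₑₓ i (λ k k<i → eq (suc k) (s≤s k<i)) lt)

  descent-<ₗₑₓ : ∀ w a → Descent w a → oneLine (w ∙ gen a ⁻¹) <ₗₑₓ oneLine w
  descent-<ₗₑₓ w a d = tabulate-<ₗₑₓ (left a)
    (λ k k<a → cong (λ x → toℕ (w · x)) (back (gen-fix a (subst (toℕ k <_) (toℕ-left a) k<a))))
    (subst (λ x → toℕ (w · x) < toℕ (w · left a)) (sym (back (gen-right a))) d)
    where
    back : ∀ {x y} → gen a · x ≡ y → gen a ⁻¹ · y ≡ x
    back refl = inverseˡ (perm (gen a))

  sort : ∀ w → Acc _<ₗₑₓ_ (oneLine w) → ∃ (HasWord w)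
  sort w (acc rec) with Fin.any? (λ i → toℕ (w · right i) ℕ.<? toℕ (w · left i))
  ... | no  none    = 0 , [] , noDescent⇒ε w (λ i d → none (i , d))
  ... | yes (a , d) with k , u , eq ← sort (w ∙ gen a ⁻¹) (rec (descent-<ₗₑₓ w a d)) =
    suc k , u ∷ʳ a , λ x →
      trans (eval-∷ʳ u a x) (trans (eq (gen a · x)) (cong (w ·_) (inverseˡ (perm (gen a)))))

  generated : (w : B n) → ∃ (HasWord w)
  generated w = sort w (<-wellFounded trans (subst (_ <_)) ℕ-<-wellFounded (oneLine w))

least : {P : ℕ → Set} → (∀ k → Dec (P k)) → ∀ k → P k → ∃ λ m → P m × (∀ j → P j → m ≤ j)
least P? k pk with P? 0
least P? k       pk | yes p0 = 0 , p0 , λ _ _ → z≤n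
least P? zero    pk | no ¬p0 = contradiction pk ¬p0
least P? (suc k) pk | no ¬p0 with m , pm , min ← least (λ j → P? (suc j)) k pk =
  suc m , pm , λ { zero p → contradiction p ¬p0 ; (suc j) p → s≤s (min j p) }

anyWord? : ∀ {n} k {P : Word n k → Set} → (∀ u → Dec (P u)) → Dec (∃ P)
anyWord? zero    P? = map′ ([] ,_) (λ { ([] , p) → p }) (P? [])
anyWord? (suc k) P? = map′ (λ { (i , u , p) → i ∷ u , p }) (λ { (i ∷ u , p) → i , u , p })
  (Fin.any? λ i → anyWord? k (λ u → P? (i ∷ u)))

_≈?_ : ∀ {n} (v w : B n) → Dec (v ≈ w)
v ≈? w = Fin.all? λ i → v · i Fin.≟ w · i

hasWord? : ∀ {n} (w : B n) k → Dec (HasWord w k)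
hasWord? w k = anyWord? k (λ u → eval u ≈? w)

ℓ-least : ∀ {n} (w : B n) → ∃ λ k → HasWord w k × (∀ j → HasWord w j → k ≤ j)
ℓ-least w = least (hasWord? w) _ (proj₂ (generated w))

ℓ : ∀ {n} → B n → ℕ
ℓ w = proj₁ (ℓ-least w)

-- The defining equation ℓ(yx⁻¹) = ℓ(y) - ℓ(x), without truncated subtraction.
_≤L_ : ∀ {n} → B n → B n → Set
x ≤L y = ℓ (y ∙ x ⁻¹) + ℓ x ≡ ℓ y

Separated : ∀ {n} → B n → (i j : Fin (2 * n)) → Set
Separated {n} w i j = ∃ λ k → (toℕ i < toℕ k × toℕ k < toℕ j) ×
  ( (toℕ k < n × toℕ (w · k) < toℕ (w · i) ⊓ toℕ (w · j))
  ⊎ (n ≤ toℕ k × toℕ (w · i) ⊔ toℕ (w · j) < toℕ (w · k)))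

-- The order i ⪯_w j. `Separated w i j` forces i < j, so both orders of the pair are excluded.
Below : ∀ {n} → B n → (i j : Fin (2 * n)) → Set
Below w i j = i ≡ j ⊎ (toℕ (w · i) < toℕ (w · j) × ¬ Separated w i j × ¬ Separated w j i)

-- The type-B sylvester congruence: the orders ⪯_v and ⪯_w coincide.
_≡ᴮ_ : ∀ {n} → B n → B n → Set
v ≡ᴮ w = ∀ i j → Below v i j ⇔ Below w i j

module _ {n : ℕ} where

  separated? : (w : B n) → ∀ i j → Dec (Separated w i j)
  separated? w i j = Fin.any? λ k → (toℕ i ℕ.<? toℕ k ×-dec toℕ k ℕ.<? toℕ j) ×-dec
    ((toℕ k ℕ.<? n ×-dec _ ℕ.<? _) ⊎-dec (n ℕ.≤? toℕ k ×-dec _ ℕ.<? _))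

  below? : (w : B n) → ∀ i j → Dec (Below w i j)
  below? w i j = i Fin.≟ j ⊎-dec
    (_ ℕ.<? _ ×-dec ¬? (separated? w i j) ×-dec ¬? (separated? w j i))

  _≡ᴮ?_ : (v w : B n) → Dec (v ≡ᴮ w)
  v ≡ᴮ? w = Fin.all? λ i → Fin.all? λ j →
    map′ (λ (f , g) → mk⇔ f g) (λ e → Equivalence.to e , Equivalence.from e)
      ((below? v i j →-dec below? w i j) ×-dec (below? w i j →-dec below? v i j))

  ≈-sym : {v w : B n} → v ≈ w → w ≈ v
  ≈-sym eq i = sym (eq i)

  ≈-trans : {u v w : B n} → u ≈ v → v ≈ w → u ≈ w
  ≈-trans eq eq′ i = trans (eq i) (eq′ i)

  separated-resp : {v w : B n} → v ≈ w → ∀ {i j} → Separated v i j → Separated w i j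
  separated-resp eq {i} {j} (k , b , s) with eq i | eq j | eq k
  ... | ei | ej | ek rewrite ei | ej | ek = k , b , s

  below-resp : {v w : B n} → v ≈ w → ∀ {i j} → Below v i j → Below w i j
  below-resp eq (inj₁ i≡j) = inj₁ i≡j
  below-resp {v} {w} eq {i} {j} (inj₂ (lt , ¬s , ¬s′)) =
    inj₂ ( subst₂ (λ x y → toℕ x < toℕ y) (eq i) (eq j) lt
         , ¬s ∘ separated-resp {w} {v} (≈-sym {v} {w} eq)
         , ¬s′ ∘ separated-resp {w} {v} (≈-sym {v} {w} eq))

  ≈⇒≡ᴮ : {v w : B n} → v ≈ w → v ≡ᴮ w
  ≈⇒≡ᴮ {v} {w} eq i j = mk⇔ (below-resp {v} {w} eq) (below-resp {w} {v} (≈-sym {v} {w} eq))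

  ≡ᴮ-trans : {u v w : B n} → u ≡ᴮ v → v ≡ᴮ w → u ≡ᴮ w
  ≡ᴮ-trans e f i j = mk⇔ (Equivalence.to (f i j) ∘ Equivalence.to (e i j))
                         (Equivalence.from (e i j) ∘ Equivalence.from (f i j))

IsMinimalInClass : ∀ {n} → B n → B n → Set
IsMinimalInClass w m = m ≡ᴮ w × (∀ v → v ≡ᴮ w → v ≤L m → v ≈ m)

-- A class member given by a word of least length is ≤L-minimal.
minimalInClass : ∀ {n} (w : B n) → ∃ (IsMinimalInClass w)
minimalInClass {n} w = fromLeast (least (λ k → anyWord? k (λ u → eval u ≡ᴮ? w)) _ (proj₂ nonEmpty))
  where
  InClass : ℕ → Set
  InClass k = ∃ λ (u : Word n k) → eval u ≡ᴮ w

  nonEmpty : ∃ InClass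
  nonEmpty with k , u , eq ← generated w = k , u , ≈⇒≡ᴮ {v = eval u} {w} eq

  fromLeast : (∃ λ k → InClass k × (∀ j → InClass j → k ≤ j)) → ∃ (IsMinimalInClass w)
  fromLeast (k , (u , u≡w) , min) = eval u , u≡w , minimal
    where
    minimal : ∀ v → v ≡ᴮ w → v ≤L eval u → v ≈ eval u
    minimal v v≡w v≤m = ≈-from (ℓ-least (eval u ∙ v ⁻¹)) ℓ-quot
      where
      k≤ℓv : k ≤ ℓ v
      k≤ℓv with j , (t , eq) , _ ← ℓ-least v =
        min j (t , ≡ᴮ-trans {u = eval t} {v} {w} (≈⇒≡ᴮ {v = eval t} {v} eq) v≡w)

      ℓm≤k : ℓ (eval u) ≤ k
      ℓm≤k = proj₂ (proj₂ (ℓ-least (eval u))) k (u , λ _ → refl)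

      ℓ-quot : ℓ (eval u ∙ v ⁻¹) ≤ 0
      ℓ-quot = ℕ.+-cancelʳ-≤ (ℓ v) _ 0 (ℕ.≤-trans (ℕ.≤-reflexive v≤m) (ℕ.≤-trans ℓm≤k k≤ℓv))

      ≈-from : (l : ∃ λ j → HasWord (eval u ∙ v ⁻¹) j × (∀ i → HasWord (eval u ∙ v ⁻¹) i → j ≤ i)) →
               proj₁ l ≤ 0 → v ≈ eval u
      ≈-from (zero , ([] , eq) , _) _ x = trans (eq (v · x)) (cong (eval u ·_) (inverseˡ (perm v)))

-- Classes have a unique minimal element, so π↓ does not depend (up to _≈_) on
-- which one the search in `minimalInClass` returns; uniqueness is not proved here.
π↓ : ∀ {n} → B n → B n
π↓ w = proj₁ (minimalInClass w)

sᴮ : ∀ {n} → B n → B n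
sᴮ w = w ∙ π↓ w ⁻¹

-- The set {w, f w, f² w, …}, as a subset of B n: its elements are compared
-- as permutations, disregarding the exponent.
Orbit : ∀ {n} → (B n → B n) → B n → Setoid 0ℓ 0ℓ
Orbit {n} f w = record
  { Carrier       = ∃ λ (v : B n) → ∃ λ t → v ≈ iterate f w t
  ; _≈_           = λ x y → proj₁ x ≈ proj₁ y
  ; isEquivalence = record
    { refl  = λ _ → refl
    ; sym   = λ {x} {y} → ≈-sym {v = proj₁ x} {proj₁ y}
    ; trans = λ {x} {y} {z} → ≈-trans {u = proj₁ x} {proj₁ y} {proj₁ z}
    }
  }

HasCardinality : Setoid 0ℓ 0ℓ → ℕ → Set
HasCardinality S k = Bijection (setoid (Fin k)) S

{-# OPTIONS --safe #-}
-- Minimal elements.  If m is minimal in the class of w then every inversion of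
-- m is an inversion of w: an offending pair of smallest gap in m would yield
-- two consecutive values of m, inverted and separated, whose exchange keeps m
-- in its class and lowers it.  Hence the inversions of sᴮ w are inversions of
-- w between separated positions.
--
-- Upper bound.  Any sequence w₀, w₁, … in which every inversion of w_{t+1} is
-- a separated inversion of w_t reaches the identity at time n: for each value
-- v < n, at time v + 1 the value v lies in the first half, and from time v + 2
-- on no larger value precedes it.  A repetition w_s ≈ w_t with s < t would make
-- the constant sequence w_s such a sequence, so an orbit consists of the
-- distinct elements w₀, …, w_t = ε with t ≤ n.
--
-- Lower bound.  In the orbit of n 0 1 … n-2 | n+1 … 2n-1 n-1, the value n
-- passes only one of the values 0, …, n-1 at each step.
module Submission where

open import Defs
open import Data.Nat.Base using (ℕ; zero; suc; _+_; _*_; _∸_; _≤_; _<_; z≤n; s≤s; s≤s⁻¹)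
import Data.Nat.Properties as ℕ
open import Data.Nat.GeneralisedArithmetic using (iterate)
open import Data.Nat.Induction using (<-wellFounded)
open import Data.Fin.Base using (Fin; zero; suc; toℕ; fromℕ<; inject₁; opposite)
import Data.Fin.Properties as Fin
open import Data.Fin.Permutation using (_⟨$⟩ʳ_; inverseˡ; inverseʳ; permutation)
open import Data.Product.Base using (∃; ∃₂; _×_; _,_; proj₁; proj₂)
open import Data.Sum.Base using (_⊎_; inj₁; inj₂; [_,_]′)
open import Data.Vec.Base using ([]; _∷_; _++_)
open import Function.Base using (_∘_)
open import Function.Bundles using (Equivalence; mk⇔)
open import Induction.WellFounded using (Acc; acc)
open import Relation.Binary.Definitions using (tri<; tri≈; tri>)
open import Relation.Binary.PropositionalEquality
open import Relation.Nullary.Decidable using (Dec; yes; no; decidable-stable)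
open import Relation.Nullary.Negation.Core using (¬_; contradiction)

-- Reversal of positions and values

infixl 10 _ᵒ

_ᵒ : ∀ {m} → Fin m → Fin m
_ᵒ = opposite

ᵒᵒ : ∀ {m} (x : Fin m) → x ᵒ ᵒ ≡ x
ᵒᵒ = Fin.opposite-involutive

module _ {m : ℕ} where

  opposite-anti-< : {x y : Fin m} → toℕ x < toℕ y → toℕ (opposite y) < toℕ (opposite x)
  opposite-anti-< {x} {y} x<y = opposite-cancel-< (subst₂ (λ a b → toℕ a < toℕ b)
    (sym (Fin.opposite-involutive x)) (sym (Fin.opposite-involutive y)) x<y)

  opposite-anti-≤ : {x y : Fin m} → toℕ x ≤ toℕ y → toℕ (opposite y) ≤ toℕ (opposite x)
  opposite-anti-≤ {x} {y} x≤y = opposite-cancel-≤ (subst₂ (λ a b → toℕ a ≤ toℕ b)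
    (sym (Fin.opposite-involutive x)) (sym (Fin.opposite-involutive y)) x≤y)

  opposite-suc : {x y : Fin m} → toℕ y ≡ suc (toℕ x) → toℕ (opposite x) ≡ suc (toℕ (opposite y))
  opposite-suc {x} {y} y≡1+x = ℕ.+-cancelʳ-≡ (suc (toℕ x)) _ _ (begin
    toℕ (opposite x) + suc (toℕ x)       ≡⟨ opposite-sum x ⟩
    m                                    ≡⟨ opposite-sum y ⟨
    toℕ (opposite y) + suc (toℕ y)       ≡⟨ cong (λ z → toℕ (opposite y) + suc z) y≡1+x ⟩
    toℕ (opposite y) + suc (suc (toℕ x)) ≡⟨ ℕ.+-suc _ _ ⟩
    suc (toℕ (opposite y)) + suc (toℕ x) ∎)
    where open ≡-Reasoning

module _ {n : ℕ} where

  opposite-≥ : {x : Fin (2 * n)} → n ≤ toℕ x → toℕ (x ᵒ) < n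
  opposite-≥ {x} n≤x = ℕ.≰⇒> λ n≤xᵒ → ℕ.<-irrefl (trans (n+n≡2*n {n}) (sym (opposite-sum x)))
    (ℕ.+-mono-≤-< n≤xᵒ (s≤s n≤x))

  ·-≮⇒> : (w : B n) {x y : Fin (2 * n)} → ¬ toℕ (w · x) < toℕ (w · y) → x ≢ y → toℕ (w · y) < toℕ (w · x)
  ·-≮⇒> w ≮ x≢y = ℕ.≤∧≢⇒< (ℕ.≮⇒≥ ≮) (λ eq → x≢y (sym (·-injective w (Fin.toℕ-injective eq))))

  ᵒ-anti-·< : (w : B n) {x y : Fin (2 * n)} → toℕ (w · x) < toℕ (w · y) → toℕ (w · (y ᵒ)) < toℕ (w · (x ᵒ))
  ᵒ-anti-·< w {x} {y} lt = subst₂ (λ a b → toℕ a < toℕ b) (sym (symm w y)) (sym (symm w x)) (opposite-anti-< lt)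

  ᵒ-anti-·≤ : (w : B n) {x y : Fin (2 * n)} → toℕ (w · x) ≤ toℕ (w · y) → toℕ (w · (y ᵒ)) ≤ toℕ (w · (x ᵒ))
  ᵒ-anti-·≤ w {x} {y} le = subst₂ (λ a b → toℕ a ≤ toℕ b) (sym (symm w y)) (sym (symm w x)) (opposite-anti-≤ le)

  ᵒ-suc-· : (w : B n) {x y : Fin (2 * n)} → toℕ (w · y) ≡ suc (toℕ (w · x)) →
            toℕ (w · (x ᵒ)) ≡ suc (toℕ (w · (y ᵒ)))
  ᵒ-suc-· w {x} {y} eq = subst₂ (λ a b → toℕ a ≡ suc (toℕ b)) (sym (symm w x)) (sym (symm w y)) (opposite-suc eq)

  inverseʳ′ : (w : B n) → ∀ {a} → w · (w ⁻¹ · a) ≡ a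
  inverseʳ′ w = inverseʳ (perm w)

  inverseˡ′ : (w : B n) → ∀ {a} → w ⁻¹ · (w · a) ≡ a
  inverseˡ′ w = inverseˡ (perm w)

  -- Reflections and the exchange property

  -- Described by its effect instead of as a product of transpositions, so that the single
  -- transposition (`q ≡ p ᵒ`) and the product of two commuting ones are treated alike.
  record Reflects (R : B n) (p q : Fin (2 * n)) : Set where
    field
      at-p  : R · p ≡ q
      at-q  : R · q ≡ p
      other : ∀ z → z ≢ p → z ≢ q → z ≢ p ᵒ → z ≢ q ᵒ → R · z ≡ z

    at-pᵒ : R · (p ᵒ) ≡ q ᵒ
    at-pᵒ = trans (symm R p) (cong opposite at-p)

    at-qᵒ : R · (q ᵒ) ≡ p ᵒ
    at-qᵒ = trans (symm R q) (cong opposite at-q)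

  open Reflects

  module _ {R S : B n} {p q : Fin (2 * n)} (r : Reflects R p q) (s : Reflects S p q) where

    reflection-unique : R ≈ S
    reflection-unique z with z Fin.≟ p | z Fin.≟ q | z Fin.≟ p ᵒ | z Fin.≟ q ᵒ
    ... | yes refl | _        | _        | _        = trans (at-p r) (sym (at-p s))
    ... | no _     | yes refl | _        | _        = trans (at-q r) (sym (at-q s))
    ... | no _     | no _     | yes refl | _        = trans (at-pᵒ r) (sym (at-pᵒ s))
    ... | no _     | no _     | no _     | yes refl = trans (at-qᵒ r) (sym (at-qᵒ s))
    ... | no a     | no b     | no c     | no d     = trans (other r z a b c d) (sym (other s z a b c d))

  -- The inverse of `R` reflects the same pair, so uniqueness identifies it with `R`.
  reflection-involutive : {R : B n} {p q : Fin (2 * n)} → Reflects R p q → ∀ z → R · (R · z) ≡ z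
  reflection-involutive {R} {p} {q} r z = trans (cong (R ·_) (reflection-unique r inverse z)) (inverseʳ′ R)
    where
    back : ∀ {x y} → R · x ≡ y → R ⁻¹ · y ≡ x
    back refl = inverseˡ′ R
    inverse : Reflects (R ⁻¹) p q
    inverse = record
      { at-p  = back (at-q r)
      ; at-q  = back (at-p r)
      ; other = λ z a b c d → back (other r z a b c d)
      }

  reflection-sym : {R : B n} {p q : Fin (2 * n)} → Reflects R p q → Reflects R q p
  reflection-sym r = record
    { at-p = at-q r ; at-q = at-p r ; other = λ z a b c d → other r z b a d c }

  reflection-ᵒ : {R : B n} {p q : Fin (2 * n)} → Reflects R p q → Reflects R (p ᵒ) (q ᵒ)
  reflection-ᵒ {R} {p} {q} r = record
    { at-p  = at-pᵒ r
    ; at-q  = at-qᵒ r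
    ; other = λ z a b c d → other r z
        (λ e → c (trans e (sym (Fin.opposite-involutive p))))
        (λ e → d (trans e (sym (Fin.opposite-involutive q)))) a b
    }

  reflection-conj : (v : B n) {R : B n} {p q : Fin (2 * n)} → Reflects R (v · p) (v · q) →
                    Reflects (v ⁻¹ ∙ R ∙ v) p q
  reflection-conj v {R} {p} {q} r = record
    { at-p  = trans (cong (v ⁻¹ ·_) (at-p r)) (inverseˡ′ v)
    ; at-q  = trans (cong (v ⁻¹ ·_) (at-q r)) (inverseˡ′ v)
    ; other = λ z a b c d → trans
        (cong (v ⁻¹ ·_) (other r (v · z) (a ∘ ·-injective v) (b ∘ ·-injective v)
          (λ e → c (·-injective v (trans e (sym (symm v p)))))
          (λ e → d (·-injective v (trans e (sym (symm v q)))))))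
        (inverseˡ′ v)
    }

  gen-left : (i : Fin n) → gen i · left i ≡ right i
  gen-left i with suc (toℕ i) ℕ.<? n
  ... | yes lt = trans (cong (adjacent i ⟨$⟩ʳ_) (mirror-fix i lt (left<n i)))
                       (transpose-left (left i) (right i))
  ... | no  _  = transpose-left (left i) (right i)

  gen-other : (i : Fin n) → ∀ z → z ≢ left i → z ≢ right i → z ≢ left i ᵒ → z ≢ right i ᵒ → gen i · z ≡ z
  gen-other i z a b c d with suc (toℕ i) ℕ.<? n
  ... | yes _ = trans (cong (adjacent i ⟨$⟩ʳ_) (transpose-fix c d)) (transpose-fix a b)
  ... | no  _ = transpose-fix a b

  gen-reflects : (i : Fin n) → Reflects (gen i) (left i) (right i)
  gen-reflects i = record { at-p = gen-left i ; at-q = gen-right i ; other = gen-other i }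

  module _ {R : B n} {a b : Fin (2 * n)} (r : Reflects R a b) (b≡1+a : toℕ b ≡ suc (toℕ a)) where

    Flipped : (x y : Fin (2 * n)) → Set
    Flipped x y = (x ≡ a × y ≡ b) ⊎ (x ≡ b ᵒ × y ≡ a ᵒ)

    flipped-suc : ∀ {x y} → Flipped x y → toℕ y ≡ suc (toℕ x)
    flipped-suc (inj₁ (refl , refl)) = b≡1+a
    flipped-suc (inj₂ (refl , refl)) = opposite-suc b≡1+a

    shift : ∀ x → R · x ≡ x ⊎ Flipped x (R · x) ⊎ Flipped (R · x) x
    shift x with x Fin.≟ a | x Fin.≟ b | x Fin.≟ a ᵒ | x Fin.≟ b ᵒ
    ... | yes refl | _        | _        | _        = inj₂ (inj₁ (inj₁ (refl , at-p r)))
    ... | no _     | yes refl | _        | _        = inj₂ (inj₂ (inj₁ (at-q r , refl)))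
    ... | no _     | no _     | yes refl | _        = inj₂ (inj₂ (inj₂ (at-pᵒ r , refl)))
    ... | no _     | no _     | no _     | yes refl = inj₂ (inj₁ (inj₂ (refl , at-qᵒ r)))
    ... | no a     | no b     | no c     | no d     = inj₁ (other r x a b c d)

    shift-≤ : ∀ x → toℕ x ≤ suc (toℕ (R · x))
    shift-≤ x with shift x
    ... | inj₁ eq        = ℕ.≤-trans (ℕ.≤-reflexive (cong toℕ (sym eq))) (ℕ.n≤1+n _)
    ... | inj₂ (inj₁ up) = ℕ.≤-trans (ℕ.<⇒≤ (ℕ.≤-reflexive (sym (flipped-suc up)))) (ℕ.n≤1+n _)
    ... | inj₂ (inj₂ dn) = ℕ.≤-reflexive (flipped-suc dn)

    -- By `shift` every point moves by at most one, so `x < y` can be reversed only if the two are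
    -- exchanged. In all other cases `R · x ≤ R · y`, and injectivity makes this strict.
    reflection-mono : ∀ x y → toℕ x < toℕ y → toℕ (R · x) < toℕ (R · y) ⊎ Flipped x y
    reflection-mono x y x<y = go (shift x)
      where
      conclude : toℕ (R · x) ≤ toℕ (R · y) → toℕ (R · x) < toℕ (R · y) ⊎ Flipped x y
      conclude le = inj₁ (ℕ.≤∧≢⇒< le
        λ eq → ℕ.<-irrefl (cong toℕ (·-injective R (Fin.toℕ-injective eq))) x<y)
      stay : toℕ (R · x) ≤ toℕ x → toℕ (R · x) < toℕ (R · y) ⊎ Flipped x y
      stay le = conclude (ℕ.≤-trans le (s≤s⁻¹ (ℕ.≤-trans x<y (shift-≤ y))))
      go : R · x ≡ x ⊎ Flipped x (R · x) ⊎ Flipped (R · x) x → toℕ (R · x) < toℕ (R · y) ⊎ Flipped x y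
      go (inj₁ eq)        = stay (ℕ.≤-reflexive (cong toℕ eq))
      go (inj₂ (inj₂ dn)) = stay (ℕ.<⇒≤ (ℕ.≤-reflexive (sym (flipped-suc dn))))
      go (inj₂ (inj₁ up)) with R · x Fin.≟ y
      ... | yes refl = inj₂ up
      ... | no  neq  = conclude (s≤s⁻¹ (ℕ.≤-trans
        (ℕ.≤∧≢⇒< (ℕ.≤-trans (ℕ.≤-reflexive (flipped-suc up)) x<y) (neq ∘ Fin.toℕ-injective)) (shift-≤ y)))

  flipped-reflects : {R : B n} {a b : Fin (2 * n)} (r : Reflects R a b) (b≡1+a : toℕ b ≡ suc (toℕ a)) →
                     ∀ {x y} → Flipped r b≡1+a x y → Reflects R x y
  flipped-reflects r _ (inj₁ (refl , refl)) = r
  flipped-reflects r _ (inj₂ (refl , refl)) = reflection-sym (reflection-ᵒ r)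

  right≡1+left : (i : Fin n) → toℕ (right i) ≡ suc (toℕ (left i))
  right≡1+left i = trans (toℕ-right i) (cong suc (sym (toℕ-left i)))

  simpleReflection : {a b : Fin (2 * n)} → toℕ b ≡ suc (toℕ a) → ∃ λ i → Reflects (gen i) a b
  simpleReflection {a} {b} b≡1+a = go (toℕ a ℕ.<? n)
    where
    inLowerHalf : ∀ {a b} → toℕ b ≡ suc (toℕ a) → toℕ a < n → ∃ λ i → Reflects (gen i) a b
    inLowerHalf b≡1+a a<n = fromℕ< a<n , subst₂ (Reflects (gen (fromℕ< a<n)))
      (Fin.toℕ-injective (trans (toℕ-left _) (Fin.toℕ-fromℕ< a<n)))
      (Fin.toℕ-injective (trans (toℕ-right _) (trans (cong suc (Fin.toℕ-fromℕ< a<n)) (sym b≡1+a))))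
      (gen-reflects (fromℕ< a<n))
    go : Dec (toℕ a < n) → ∃ λ i → Reflects (gen i) a b
    go (yes a<n) = inLowerHalf b≡1+a a<n
    -- A pair in the upper half has its mirror image in the lower half, and a reflection of one is a
    -- reflection of the other.
    go (no  a≮n) with inLowerHalf (opposite-suc b≡1+a)
                        (opposite-≥ (ℕ.≤-trans (ℕ.≮⇒≥ a≮n) (ℕ.<⇒≤ (ℕ.≤-reflexive (sym b≡1+a)))))
    ... | i , r = i , subst₂ (Reflects (gen i)) (Fin.opposite-involutive a) (Fin.opposite-involutive b)
                        (reflection-sym (reflection-ᵒ r))

  -- The letter to delete is the one that inverts positions p and q.
  exchange : ∀ {k} (u : Word n k) {R : B n} {p q} → Reflects R p q → toℕ p < toℕ q →
             toℕ (eval u · q) < toℕ (eval u · p) → ∃ λ k′ → k ≡ suc k′ × HasWord (eval u ∙ R) k′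
  exchange []      r p<q d = contradiction p<q (ℕ.<⇒≯ d)
  exchange (_∷_ {n = k} i u) {R} {p} {q} r p<q d with toℕ (eval u · p) ℕ.<? toℕ (eval u · q)
  ... | no ≮ with k′ , refl , u′ , eq ← exchange u r p<q (·-≮⇒> (eval u) ≮ (Fin.<⇒≢ p<q)) =
    suc k′ , refl , i ∷ u′ , λ z → cong (gen i ·_) (eq z)
  ... | yes < with reflection-mono (gen-reflects i) (right≡1+left i) _ _ <
  ...   | inj₁ <′ = contradiction <′ (ℕ.<⇒≯ d)
  ...   | inj₂ f  = k , refl , u , λ z → sym (trans
    (cong (λ x → gen i · (eval u · x)) (reflection-unique r (reflection-conj (eval u) r′) z))
    (trans (cong (gen i ·_) (inverseʳ′ (eval u))) (reflection-involutive r′ (eval u · z))))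
    where
    r′ : Reflects (gen i) (eval u · p) (eval u · q)
    r′ = flipped-reflects (gen-reflects i) (right≡1+left i) f

  -- Coxeter length and the left weak order

  eval-++ : ∀ {k l} (u : Word n k) (t : Word n l) → eval (u ++ t) ≈ eval u ∙ eval t
  eval-++ []      t x = refl
  eval-++ (i ∷ u) t x = cong (gen i ·_) (eval-++ u t x)

  hasWord-resp : {v w : B n} → v ≈ w → ∀ {k} → HasWord v k → HasWord w k
  hasWord-resp eq (u , e) = u , λ x → trans (e x) (eq x)

  hasWord-ℓ : (w : B n) → HasWord w (ℓ w)
  hasWord-ℓ w = proj₁ (proj₂ (ℓ-least w))

  ℓ-minimal : (w : B n) → ∀ {k} → HasWord w k → ℓ w ≤ k
  ℓ-minimal w = proj₂ (proj₂ (ℓ-least w)) _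

  ℓ-∙ : (v w : B n) → ℓ (v ∙ w) ≤ ℓ v + ℓ w
  ℓ-∙ v w with hasWord-ℓ v | hasWord-ℓ w
  ... | u , eq | t , eq′ = ℓ-minimal (v ∙ w)
    (u ++ t , λ x → trans (eval-++ u t x) (trans (eq (eval t · x)) (cong (v ·_) (eq′ x))))

  ℓ-resp : {v w : B n} → v ≈ w → ℓ v ≤ ℓ w
  ℓ-resp {v} {w} eq = ℓ-minimal v (hasWord-resp {w} {v} (≈-sym {v = v} {w} eq) (hasWord-ℓ w))

  -- The quotient of `w` by `gen i ∙ w` is `gen i`, of length at most one. The conjugate
  -- `w ⁻¹ ∙ gen i ∙ w` reflects the inverted positions `p`, `q`, so `exchange` shortens a least
  -- word of `w` to a word of `gen i ∙ w`. The reverse inequality is subadditivity of `ℓ`.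
  gen-≤L : (w : B n) (i : Fin n) {p q : Fin (2 * n)} → Reflects (gen i) (w · q) (w · p) →
           toℕ p < toℕ q → toℕ (w · q) < toℕ (w · p) → gen i ∙ w ≤L w
  gen-≤L w i {p} {q} r p<q d = ℕ.≤-antisym
    (ℕ.≤-trans (ℕ.+-monoˡ-≤ (ℓ w′) (ℓ-minimal (w ∙ w′ ⁻¹) (i ∷ [] , quotient))) shorter)
    (ℕ.≤-trans (ℓ-resp {w} {(w ∙ w′ ⁻¹) ∙ w′} λ x → cong (w ·_) (sym (inverseˡ′ w′))) (ℓ-∙ (w ∙ w′ ⁻¹) w′))
    where
    w′ : B n
    w′ = gen i ∙ w
    quotient : ∀ x → gen i · x ≡ w · (w ⁻¹ · (gen i ⁻¹ · x))
    quotient x = sym (trans (inverseʳ′ w) (·-injective (gen i)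
      (trans (inverseʳ′ (gen i)) (sym (reflection-involutive r x)))))
    R : B n
    R = w ⁻¹ ∙ gen i ∙ w
    shorter : suc (ℓ w′) ≤ ℓ w
    shorter with hasWord-ℓ w
    ... | u , eq with exchange u (reflection-conj w (reflection-sym r)) p<q
                     (subst₂ (λ a b → toℕ a < toℕ b) (sym (eq q)) (sym (eq p)) d)
    ...   | k , k≡ , word = subst (suc (ℓ w′) ≤_) (sym k≡) (s≤s (ℓ-minimal w′
      (hasWord-resp {eval u ∙ R} {w′} (λ x → trans (eq (R · x)) (inverseʳ′ w)) word)))

module _ {n : ℕ} where

  -- Separated positions

  record Low (w : B n) (x y k : Fin (2 * n)) : Set where
    constructor low
    field
      after  : toℕ x < toℕ k
      before : toℕ k < toℕ y
      half   : toℕ k < n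
      below₁ : toℕ (w · k) < toℕ (w · x)
      below₂ : toℕ (w · k) < toℕ (w · y)

  record High (w : B n) (x y k : Fin (2 * n)) : Set where
    constructor high
    field
      after  : toℕ x < toℕ k
      before : toℕ k < toℕ y
      half   : n ≤ toℕ k
      above₁ : toℕ (w · x) < toℕ (w · k)
      above₂ : toℕ (w · y) < toℕ (w · k)

  view : (w : B n) → ∀ {x y} → Separated w x y → ∃ λ k → Low w x y k ⊎ High w x y k
  view w {x} {y} (k , (x<k , k<y) , inj₁ (k<n , lt)) = k , inj₁ (low x<k k<y k<n
    (ℕ.<-≤-trans lt (ℕ.m⊓n≤m _ (toℕ (w · y)))) (ℕ.<-≤-trans lt (ℕ.m⊓n≤n (toℕ (w · x)) _)))
  view w {x} {y} (k , (x<k , k<y) , inj₂ (n≤k , lt)) = k , inj₂ (high x<k k<y n≤k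
    (ℕ.≤-<-trans (ℕ.m≤m⊔n _ (toℕ (w · y))) lt) (ℕ.≤-<-trans (ℕ.m≤n⊔m (toℕ (w · x)) _) lt))

  separated-low : (w : B n) → ∀ {x y k} → Low w x y k → Separated w x y
  separated-low w (low x<k k<y k<n kx ky) = _ , (x<k , k<y) , inj₁ (k<n , ℕ.⊓-glb kx ky)

  separated-high : (w : B n) → ∀ {x y k} → High w x y k → Separated w x y
  separated-high w (high x<k k<y n≤k xk yk) = _ , (x<k , k<y) , inj₂ (n≤k , ℕ.⊔-lub xk yk)

  separated-< : (w : B n) → ∀ {x y} → Separated w x y → toℕ x < toℕ y
  separated-< w (_ , (x<k , k<y) , _) = ℕ.<-trans x<k k<y

  -- Together with `high-ᵒ`, this lets `Swap` argue about low separators and obtain the high ones by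
  -- reversal.
  low-ᵒ : (w : B n) → ∀ {x y k} → Low w x y k → High w (y ᵒ) (x ᵒ) (k ᵒ)
  low-ᵒ w (low x<k k<y k<n kx ky) =
    high (opposite-anti-< k<y) (opposite-anti-< x<k) (opposite-< k<n) (ᵒ-anti-·< w ky) (ᵒ-anti-·< w kx)

  high-ᵒ : (w : B n) → ∀ {x y k} → High w x y k → Low w (y ᵒ) (x ᵒ) (k ᵒ)
  high-ᵒ w (high x<k k<y n≤k xk yk) =
    low (opposite-anti-< k<y) (opposite-anti-< x<k) (opposite-≥ n≤k) (ᵒ-anti-·< w yk) (ᵒ-anti-·< w xk)

  separated-ᵒ : (w : B n) → ∀ {x y} → Separated w x y → Separated w (y ᵒ) (x ᵒ)
  separated-ᵒ w s with view w s
  ... | _ , inj₁ l = separated-high w (low-ᵒ w l)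
  ... | _ , inj₂ h = separated-low w (high-ᵒ w h)

  separated-ᵒ⁻ : (w : B n) → ∀ {x y} → Separated w (y ᵒ) (x ᵒ) → Separated w x y
  separated-ᵒ⁻ w {x} {y} s = subst₂ (Separated w) (ᵒᵒ x) (ᵒᵒ y) (separated-ᵒ w s)

  -- Unseparated inversions are shared by all members of a class: `below-intro` and `below-elim`
  -- translate between them and `Below`, which `≡ᴮ` transports.
  below-intro : (w : B n) → ∀ {x y} → toℕ x < toℕ y → toℕ (w · y) < toℕ (w · x) →
                ¬ Separated w x y → Below w y x
  below-intro w x<y d ¬s = inj₂ (d , (λ s → ℕ.<-asym x<y (separated-< w s)) , ¬s)

  below-elim : (w : B n) → ∀ {x y} → toℕ x < toℕ y → Below w y x →
               toℕ (w · y) < toℕ (w · x) × ¬ Separated w x y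
  below-elim w x<y (inj₁ refl)        = contradiction refl (ℕ.<⇒≢ x<y)
  below-elim w x<y (inj₂ (d , _ , s)) = d , s

  -- Simple reflections inside a class

  module Swap (m : B n) {p q : Fin (2 * n)} (p<q : toℕ p < toℕ q)
              (mp≡1+mq : toℕ (m · p) ≡ suc (toℕ (m · q)))
              (sep : Separated m p q)
              -- The only way the exchange can create a separation by a low separator: `p`, whose
              -- value drops below that of `q`, may come to separate an earlier `x` from `q`.
              -- `gainᵒ` covers the mirrored pair.
              (gain : ∀ x → toℕ x < toℕ p → toℕ p < n → toℕ (m · p) < toℕ (m · x) → Separated m x q)
              (gainᵒ : ∀ x → toℕ x < toℕ (q ᵒ) → toℕ (q ᵒ) < n → toℕ (m · (q ᵒ)) < toℕ (m · x) →
                       Separated m x (p ᵒ))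
              where

    i : Fin n
    i = proj₁ (simpleReflection mp≡1+mq)

    r : Reflects (gen i) (m · q) (m · p)
    r = proj₂ (simpleReflection mp≡1+mq)

    m′ : B n
    m′ = gen i ∙ m

    Flip : (x y : Fin (2 * n)) → Set
    Flip x y = (x ≡ q × y ≡ p) ⊎ (x ≡ p ᵒ × y ≡ q ᵒ)

    flip-suc : ∀ {x y} → Flip x y → toℕ (m · y) ≡ suc (toℕ (m · x))
    flip-suc (inj₁ (refl , refl)) = mp≡1+mq
    flip-suc (inj₂ (refl , refl)) = ᵒ-suc-· m mp≡1+mq

    flip-> : ∀ {x y} → Flip x y → toℕ y < toℕ x
    flip-> (inj₁ (refl , refl)) = p<q
    flip-> (inj₂ (refl , refl)) = opposite-anti-< p<q

    flip-separated : ∀ {x y} → Flip x y → Separated m y x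
    flip-separated (inj₁ (refl , refl)) = sep
    flip-separated (inj₂ (refl , refl)) = separated-ᵒ m sep

    up : ∀ {x y} → toℕ (m · x) < toℕ (m · y) → toℕ (m′ · x) < toℕ (m′ · y) ⊎ Flip x y
    up {x} {y} lt with reflection-mono r mp≡1+mq (m · x) (m · y) lt
    ... | inj₁ lt′               = inj₁ lt′
    ... | inj₂ (inj₁ (ex , ey))  = inj₂ (inj₁ (·-injective m ex , ·-injective m ey))
    ... | inj₂ (inj₂ (ex , ey))  = inj₂ (inj₂
      (·-injective m (trans ex (sym (symm m p))) , ·-injective m (trans ey (sym (symm m q)))))

    down : ∀ {x y} → toℕ (m′ · x) < toℕ (m′ · y) → toℕ (m · x) < toℕ (m · y) ⊎ Flip y x
    down {x} {y} lt with toℕ (m · x) ℕ.<? toℕ (m · y)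
    ... | yes lt′ = inj₁ lt′
    ... | no  ≮ with up (·-≮⇒> m ≮ λ { refl → ℕ.<-irrefl refl lt })
    ...   | inj₁ gt = contradiction gt (ℕ.<⇒≯ lt)
    ...   | inj₂ f  = inj₂ f

    -- A flip concerns consecutive values, so a value strictly in between excludes it.
    up-wide : ∀ {x z y} → toℕ (m · x) < toℕ (m · z) → toℕ (m · z) < toℕ (m · y) →
              toℕ (m′ · x) < toℕ (m′ · y)
    up-wide x<z z<y with up (ℕ.<-trans x<z z<y)
    ... | inj₁ lt = lt
    ... | inj₂ f  = contradiction (ℕ.<-≤-trans x<z (s≤s⁻¹ (ℕ.≤-trans z<y (ℕ.≤-reflexive (flip-suc f)))))
                                  (ℕ.<-irrefl refl)

    -- The exchange raises `k` above `x`, so `k` no longer separates. The separator of the flipped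
    -- pair replaces it: it precedes `k`, hence lies in the first half and is low, and its value is
    -- below that of `k`.
    flip-low : ∀ {x y k} → Flip k x → Low m x y k → Separated m′ x y
    flip-low {x} {y} {k} f l with view m (flip-separated f)
    ... | j , inj₂ h = contradiction (ℕ.<-trans (High.before h) (Low.half l)) (ℕ.≤⇒≯ (High.half h))
    ... | j , inj₁ l′ = separated-low m′ (low (Low.after l′) (ℕ.<-trans (Low.before l′) (Low.before l)) (Low.half l′)
      (up-wide (Low.below₂ l′) (Low.below₁ l)) (up-wide (Low.below₂ l′) (Low.below₂ l)))

    preserve-low : ∀ {x y k} → Low m x y k → Separated m′ x y
    preserve-low l@(low x<k k<y k<n kx ky) with up kx | up ky
    ... | inj₂ f | _      = flip-low f l
    ... | inj₁ _ | inj₂ f = contradiction (flip-> f) (ℕ.<⇒≯ k<y)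
    ... | inj₁ a | inj₁ b = separated-low m′ (low x<k k<y k<n a b)

    preserve : ∀ {x y} → Separated m x y → Separated m′ x y
    preserve s with view m s
    ... | _ , inj₁ l = preserve-low l
    ... | _ , inj₂ h = separated-ᵒ⁻ m′ (preserve-low (high-ᵒ m h))

    reflect-low : ∀ {x y k} → Low m′ x y k → Separated m x y
    reflect-low (low x<k k<y k<n kx ky) with down kx | down ky
    ... | inj₂ f | _      = contradiction (flip-> f) (ℕ.<⇒≯ x<k)
    ... | inj₁ a | inj₁ b = separated-low m (low x<k k<y k<n a b)
    ... | inj₁ a | inj₂ (inj₁ (refl , refl)) = gain _ x<k k<n a
    ... | inj₁ a | inj₂ (inj₂ (refl , refl)) = gainᵒ _ x<k k<n a

    reflect : ∀ {x y} → Separated m′ x y → Separated m x y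
    reflect s with view m′ s
    ... | _ , inj₁ l = reflect-low l
    ... | _ , inj₂ h = separated-ᵒ⁻ m (reflect-low (high-ᵒ m′ h))

    -- By `preserve` and `reflect` the separations agree. Only the flips change their order of
    -- values, and they are separated, hence incomparable on both sides.
    m′≡ᴮm : m′ ≡ᴮ m
    m′≡ᴮm x y = mk⇔ to from
      where
      to : Below m′ x y → Below m x y
      to (inj₁ eq) = inj₁ eq
      to (inj₂ (lt , s , s′)) with down lt
      ... | inj₁ lt′ = inj₂ (lt′ , s ∘ preserve , s′ ∘ preserve)
      ... | inj₂ f   = contradiction (preserve (flip-separated f)) s
      from : Below m x y → Below m′ x y
      from (inj₁ eq) = inj₁ eq
      from (inj₂ (lt , s , s′)) with up lt
      ... | inj₁ lt′ = inj₂ (lt′ , s ∘ reflect , s′ ∘ reflect)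
      ... | inj₂ f   = contradiction (flip-separated f) s′

    notMinimal : (w : B n) → ¬ IsMinimalInClass w m
    notMinimal w (m≡w , min) = ℕ.<-irrefl
      (cong toℕ (trans (sym (min m′ (≡ᴮ-trans {u = m′} {m} {w} m′≡ᴮm m≡w) m′≤m q)) (Reflects.at-p r)))
      (ℕ.≤-reflexive (sym mp≡1+mq))
      where
      m′≤m : m′ ≤L m
      m′≤m = gen-≤L m i r p<q (ℕ.≤-reflexive (sym mp≡1+mq))

-- Inversions of the minimal element of a class

crossing : ∀ {N} (P : Fin N → Set) → (∀ x → Dec (P x)) → ∀ {a b} → toℕ a ≤ toℕ b → P a → ¬ P b →
           ∃₂ λ x y → toℕ y ≡ suc (toℕ x) × toℕ a ≤ toℕ x × toℕ y ≤ toℕ b × P x × ¬ P y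
crossing {N} P P? {a} {b} a≤b Pa ¬Pb = go (toℕ b) a (ℕ.m≤m+n _ _) a≤b Pa
  where
  go : ∀ d x → toℕ b ≤ d + toℕ x → toℕ x ≤ toℕ b → P x →
       ∃₂ λ x′ y → toℕ y ≡ suc (toℕ x′) × toℕ x ≤ toℕ x′ × toℕ y ≤ toℕ b × P x′ × ¬ P y
  go d x b≤ x≤b Px with toℕ x ℕ.≟ toℕ b
  ... | yes eq = contradiction (subst P (Fin.toℕ-injective eq) Px) ¬Pb
  go zero    x b≤ x≤b Px | no neq = contradiction (ℕ.≤-antisym x≤b b≤) neq
  go (suc d) x b≤ x≤b Px | no neq = step (P? y)
    where
    x<b : toℕ x < toℕ b
    x<b = ℕ.≤∧≢⇒< x≤b neq
    x+1<N : suc (toℕ x) < N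
    x+1<N = ℕ.≤-<-trans x<b (Fin.toℕ<n b)
    y : Fin N
    y = fromℕ< x+1<N
    y≡ : toℕ y ≡ suc (toℕ x)
    y≡ = Fin.toℕ-fromℕ< x+1<N
    y≤b : toℕ y ≤ toℕ b
    y≤b = subst (_≤ toℕ b) (sym y≡) x<b
    step : Dec (P y) → _
    step (no ¬Py) = x , y , y≡ , ℕ.≤-refl , y≤b , Px , ¬Py
    step (yes Py) with go d y (subst (toℕ b ≤_) (trans (sym (ℕ.+-suc d _)) (cong (d +_) (sym y≡))) b≤) y≤b Py
    ... | x′ , y′ , e , le , rest = x′ , y′ , e , ℕ.≤-trans (ℕ.n≤1+n _) (subst (_≤ toℕ x′) y≡ le) , rest

module _ {n : ℕ} where

  module _ (m w : B n) (m≡w : m ≡ᴮ w) where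

    private
      m⇒w : ∀ {x y} → Below m x y → Below w x y
      m⇒w = Equivalence.to (m≡w _ _)

      w⇒m : ∀ {x y} → Below w x y → Below m x y
      w⇒m = Equivalence.from (m≡w _ _)

    -- If x and q were not separated, then x would exceed j in m, hence in w,
    -- hence exceed i in w, hence in m. If p ≢ i then p separates x from i in m;
    -- if p ≡ i then i separates x from j in w.
    separated-beyond : ∀ {i j p q} → toℕ i < toℕ j → toℕ (m · j) < toℕ (m · i) → toℕ (w · i) < toℕ (w · j) →
      toℕ p ≤ toℕ i → toℕ j ≤ toℕ q → toℕ (m · j) ≤ toℕ (m · q) → toℕ (m · q) < toℕ (m · p) →
      toℕ (m · p) ≤ toℕ (m · i) →
      ∀ x → toℕ x < toℕ p → toℕ p < n → toℕ (m · p) < toℕ (m · x) → Separated m x q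
    separated-beyond {i} {j} {p} {q} i<j mj<mi wi<wj p≤i j≤q mj≤mq mq<mp mp≤mi x x<p p<n mp<mx
      with separated? m x q
    ... | yes xq = xq
    ... | no ¬xq = absurd
      where
      x<i : toℕ x < toℕ i
      x<i = ℕ.<-≤-trans x<p p≤i
      x<j : toℕ x < toℕ j
      x<j = ℕ.<-trans x<i i<j
      mj<mx : toℕ (m · j) < toℕ (m · x)
      mj<mx = ℕ.≤-<-trans mj≤mq (ℕ.<-trans mq<mp mp<mx)
      mq<mx : toℕ (m · q) < toℕ (m · x)
      mq<mx = ℕ.<-trans mq<mp mp<mx

      ¬xj : ¬ Separated m x j
      ¬xj xj with view m xj
      ... | k , inj₁ (low a b c d e)  = ¬xq (separated-low m (low a (ℕ.<-≤-trans b j≤q) c d (ℕ.<-≤-trans e mj≤mq)))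
      ... | k , inj₂ (high a b c d e) = ¬xq (separated-high m (high a (ℕ.<-≤-trans b j≤q) c d (ℕ.<-trans mq<mx d)))

      w-xj : toℕ (w · j) < toℕ (w · x) × ¬ Separated w x j
      w-xj = below-elim w x<j (m⇒w (below-intro m x<j mj<mx ¬xj))

      wi<wx : toℕ (w · i) < toℕ (w · x)
      wi<wx = ℕ.<-trans wi<wj (proj₁ w-xj)

      ¬xi : ¬ Separated w x i
      ¬xi xi with view w xi
      ... | k , inj₁ (low a b c d e)  = proj₂ w-xj (separated-low w (low a (ℕ.<-trans b i<j) c d (ℕ.<-trans e wi<wj)))
      ... | k , inj₂ (high a b c d e) = proj₂ w-xj (separated-high w (high a (ℕ.<-trans b i<j) c d (ℕ.<-trans (proj₁ w-xj) d)))

      m-xi : toℕ (m · i) < toℕ (m · x) × ¬ Separated m x i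
      m-xi = below-elim m x<i (w⇒m (below-intro w x<i wi<wx ¬xi))

      absurd : Separated m x q
      absurd with p Fin.≟ i
      ... | yes refl = contradiction (separated-low w (low x<i i<j p<n wi<wx wi<wj)) (proj₂ w-xj)
      ... | no  p≢i  = contradiction
        (separated-low m (low x<p (ℕ.≤∧≢⇒< p≤i (p≢i ∘ Fin.toℕ-injective)) p<n mp<mx
          (ℕ.≤∧≢⇒< mp≤mi (p≢i ∘ ·-injective m ∘ Fin.toℕ-injective)))) (proj₂ m-xi)

  minimal-inversions : (w m : B n) → IsMinimalInClass w m → ∀ i j → toℕ i < toℕ j →
                       toℕ (m · j) < toℕ (m · i) → toℕ (w · j) < toℕ (w · i)
  minimal-inversions w m min@(m≡w , _) i j i<j = go (toℕ (m · i)) i j (ℕ.m≤m+n _ _) i<j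
    where
    -- Induction on a bound `d` for the gap `m · i - m · j` replaces the choice of an offending pair
    -- of smallest gap.
    go : ∀ d i j → toℕ (m · i) ≤ d + toℕ (m · j) → toℕ i < toℕ j →
         toℕ (m · j) < toℕ (m · i) → toℕ (w · j) < toℕ (w · i)
    go zero    i j gap i<j mj<mi = contradiction mj<mi (ℕ.≤⇒≯ gap)
    go (suc d) i j gap i<j mj<mi = ·-≮⇒> w wi≮wj (Fin.<⇒≢ i<j)
      where
      wi≮wj : ¬ toℕ (w · i) < toℕ (w · j)
      -- Going up through the values from `m · j` to `m · i`, the position starts at `j` and ends at
      -- `i < j`. Some consecutive values therefore have positions `q ≥ j` and `p < j`.
      wi≮wj wi<wj = between (crossing (λ v → toℕ j ≤ toℕ (m ⁻¹ · v)) (λ v → toℕ j ℕ.≤? toℕ (m ⁻¹ · v))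
                               (ℕ.<⇒≤ mj<mi) (ℕ.≤-reflexive (cong toℕ (sym (inverseˡ′ m))))
                               (λ le → ℕ.<⇒≱ i<j (subst (λ z → toℕ j ≤ toℕ z) (inverseˡ′ m) le)))
        where
        -- An unseparated inversion of `m` would be an inversion of `w`.
        s : Separated m i j
        s = decidable-stable (separated? m i j) λ ¬s → ℕ.<-asym wi<wj
          (proj₁ (below-elim w i<j (Equivalence.to (m≡w _ _) (below-intro m i<j mj<mi ¬s))))

        between : (∃₂ λ x y → toℕ y ≡ suc (toℕ x) × toℕ (m · j) ≤ toℕ x × toℕ y ≤ toℕ (m · i) ×
                   toℕ j ≤ toℕ (m ⁻¹ · x) × ¬ toℕ j ≤ toℕ (m ⁻¹ · y)) → _
        between (x , y , y≡1+x , mj≤x , y≤mi , j≤q , j≰p) =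
          Swap.notMinimal m p<q mp≡1+mq sep
            (separated-beyond m w m≡w i<j mj<mi wi<wj p≤i j≤q mj≤mq mq<mp mp≤mi)
            (separated-beyond m w m≡w (opposite-anti-< {x = i} {j} i<j) (ᵒ-anti-·< m mj<mi) (ᵒ-anti-·< w wi<wj)
              (opposite-anti-≤ j≤q) (opposite-anti-≤ p≤i) (ᵒ-anti-·≤ m mp≤mi) (ᵒ-anti-·< m mq<mp)
              (ᵒ-anti-·≤ m mj≤mq))
            w min
          where
          p q : Fin (2 * n)
          p = m ⁻¹ · y
          q = m ⁻¹ · x
          mp≡1+mq : toℕ (m · p) ≡ suc (toℕ (m · q))
          mp≡1+mq = subst₂ (λ a b → toℕ a ≡ suc (toℕ b)) (sym (inverseʳ′ m)) (sym (inverseʳ′ m)) y≡1+x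
          mq<mp : toℕ (m · q) < toℕ (m · p)
          mq<mp = ℕ.≤-reflexive (sym mp≡1+mq)
          mj≤mq : toℕ (m · j) ≤ toℕ (m · q)
          mj≤mq = subst (λ z → _ ≤ toℕ z) (sym (inverseʳ′ m)) mj≤x
          mp≤mi : toℕ (m · p) ≤ toℕ (m · i)
          mp≤mi = subst (λ z → toℕ z ≤ _) (sym (inverseʳ′ m)) y≤mi
          p<j : toℕ p < toℕ j
          p<j = ℕ.≰⇒> j≰p
          p≤i : toℕ p ≤ toℕ i
          -- Otherwise `p` lies strictly between `i` and `j` in position and in value, and induction
          -- on the two smaller gaps gives `w · j < w · p < w · i`.
          p≤i = ℕ.≮⇒≥ λ i<p →
            let mp<mi = ℕ.≤∧≢⇒< mp≤mi (λ eq → ℕ.<-irrefl (cong toℕ (·-injective m (Fin.toℕ-injective (sym eq)))) i<p)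
                mj<mp = ℕ.≤-<-trans mj≤mq mq<mp
            in ℕ.<-asym wi<wj (ℕ.<-trans
                 (go d p j (s≤s⁻¹ (ℕ.≤-trans mp<mi gap)) p<j mj<mp)
                 (go d i p (ℕ.≤-trans gap (ℕ.≤-trans (ℕ.≤-reflexive (sym (ℕ.+-suc d _))) (ℕ.+-monoʳ-≤ d mj<mp))) i<p mp<mi))
          p<q : toℕ p < toℕ q
          p<q = ℕ.<-≤-trans p<j j≤q
          -- The separator of `i` and `j` also serves here: `p` and `q` are at least as far apart in
          -- position, and their values lie between `m · j` and `m · i`.
          sep : Separated m p q
          sep with view m s
          ... | k , inj₁ (low a b c _ e) = separated-low m (low (ℕ.≤-<-trans p≤i a) (ℕ.<-≤-trans b j≤q) c
                  (ℕ.<-trans (ℕ.<-≤-trans e mj≤mq) mq<mp) (ℕ.<-≤-trans e mj≤mq))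
          ... | k , inj₂ (high a b c d _) = separated-high m (high (ℕ.≤-<-trans p≤i a) (ℕ.<-≤-trans b j≤q) c
                  (ℕ.≤-<-trans mp≤mi d) (ℕ.<-trans mq<mp (ℕ.≤-<-trans mp≤mi d)))

-- Inverted values and a single sorting step

module _ {n : ℕ} where

  Before : B n → (a b : Fin (2 * n)) → Set
  Before w a b = toℕ (w ⁻¹ · a) < toℕ (w ⁻¹ · b)

  before-ᵒ : (w : B n) → ∀ {a b} → Before w a b → Before w (b ᵒ) (a ᵒ)
  before-ᵒ w = ᵒ-anti-·< (w ⁻¹)

  record Step (w w′ : B n) : Set where
    constructor mkStep
    field
      inversion : ∀ {a b} → toℕ a < toℕ b → Before w′ b a →
                  Before w b a × Separated w (w ⁻¹ · b) (w ⁻¹ · a)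

  open Step public

  -- A separator named by its value. For `a < b`, the comparison with the other member of the pair
  -- follows from the one recorded.
  data Between (w : B n) (b a : Fin (2 * n)) : Set where
    lower : ∀ c → Before w b c → Before w c a → toℕ (w ⁻¹ · c) < n → toℕ c < toℕ a → Between w b a
    upper : ∀ c → Before w b c → Before w c a → n ≤ toℕ (w ⁻¹ · c) → toℕ b < toℕ c → Between w b a

  between : (w : B n) → ∀ {a b} → Separated w (w ⁻¹ · b) (w ⁻¹ · a) → Between w b a
  between w {a} {b} s with view w s
  ... | k , inj₁ (low p q r _ l) = lower (w · k)
    (subst (λ z → _ < toℕ z) (sym (inverseˡ′ w)) p) (subst (λ z → toℕ z < _) (sym (inverseˡ′ w)) q)
    (subst (λ z → toℕ z < n) (sym (inverseˡ′ w)) r) (subst (λ z → _ < toℕ z) (inverseʳ′ w) l)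
  ... | k , inj₂ (high p q r l _) = upper (w · k)
    (subst (λ z → _ < toℕ z) (sym (inverseˡ′ w)) p) (subst (λ z → toℕ z < _) (sym (inverseˡ′ w)) q)
    (subst (λ z → n ≤ toℕ z) (sym (inverseˡ′ w)) r) (subst (λ z → toℕ z < _) (inverseʳ′ w) l)

  sorted⇒ε : (w : B n) → (∀ {a b} → toℕ a < toℕ b → ¬ Before w b a) → ε ≈ w
  sorted⇒ε w sorted = noDescent⇒ε w λ i d → sorted d
    (subst₂ (λ x y → toℕ x < toℕ y) (sym (inverseˡ′ w)) (sym (inverseˡ′ w))
      (ℕ.≤-reflexive (sym (right≡1+left i))))

  module _ (w m : B n) (min : IsMinimalInClass w m) where

    private
      w′ : B n
      w′ = w ∙ m ⁻¹

    -- In `w ∙ m ⁻¹` the value `a` stands at position `m · (w ⁻¹ · a)`, so `Before w′` compares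
    -- values of `m`. Were `a` before `b` in `w`, their positions would be inverted in `m` but not
    -- in `w`. Were the inversion unseparated in `w`, it would persist in `m` and put `a` before `b`
    -- in `w′`.
    minimal-step : Step w w′
    minimal-step = mkStep λ {a} {b} → step a b
      where
      step : ∀ a b → toℕ a < toℕ b → Before w′ b a → Before w b a × Separated w (w ⁻¹ · b) (w ⁻¹ · a)
      step a b a<b b<′a = b<a , decidable-stable (separated? w i j) λ ¬s →
        ℕ.<-asym b<′a (proj₁ (below-elim m b<a (Equivalence.from (proj₁ min _ _) (below-intro w b<a wj<wi ¬s))))
        where
        i j : Fin (2 * n)
        i = w ⁻¹ · b
        j = w ⁻¹ · a
        wj<wi : toℕ (w · j) < toℕ (w · i)
        wj<wi = subst₂ (λ x y → toℕ x < toℕ y) (sym (inverseʳ′ w)) (sym (inverseʳ′ w)) a<b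
        b<a : toℕ i < toℕ j
        b<a = ℕ.≰⇒> λ j≤i → ℕ.<-asym wj<wi (minimal-inversions w m min j i
          (ℕ.≤∧≢⇒< j≤i (λ eq → ℕ.<-irrefl (cong (λ x → toℕ (w · x)) (Fin.toℕ-injective eq)) wj<wi)) b<′a)

  sᴮ-step : (w : B n) → Step w (sᴮ w)
  sᴮ-step w = minimal-step w (π↓ w) (proj₂ (minimalInClass w))

  -- Sequences of steps are sorted by time `n`

  module Sorting (W : ℕ → B n) (steps : ∀ t → Step (W t) (W (suc t))) where

    earlier : ∀ s d {a b} → toℕ a < toℕ b → Before (W (d + s)) b a → Before (W s) b a
    earlier s zero    a<b x = x
    earlier s (suc d) a<b x = earlier s d a<b (proj₁ (inversion (steps (d + s)) a<b x))

    earlier-≤ : ∀ {s t} → s ≤ t → ∀ {a b} → toℕ a < toℕ b → Before (W t) b a → Before (W s) b a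
    earlier-≤ {s} {t} s≤t {a} {b} a<b x = earlier s (t ∸ s) a<b
      (subst (λ z → Before (W z) b a) (sym (ℕ.m∸n+n≡m s≤t)) x)

    separator : ∀ t {a b} → toℕ a < toℕ b → Before (W (suc t)) b a → Between (W t) b a
    separator t a<b x = between (W t) (proj₂ (inversion (steps t) a<b x))

    -- Since `v ᵒ` stands at the position opposite to that of `v`, it precedes `v` exactly when `v`
    -- is in the second half.
    FirstHalf Placed : Fin (2 * n) → Set
    FirstHalf v = ¬ Before (W (suc (toℕ v))) (v ᵒ) v
    Placed    v = ∀ t → 2 + toℕ v ≤ t → ∀ x → toℕ v < toℕ x → ¬ Before (W t) x v

    v<vᵒ : ∀ {v : Fin (2 * n)} → toℕ v < n → toℕ v < toℕ (v ᵒ)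
    v<vᵒ v<n = ℕ.<-≤-trans v<n (opposite-< v<n)

    -- If vᵒ came before v at time v + 1, then, inductively for k = v, …, 0,
    -- vᵒ would come before k at time k + 1: a chain of low separators that
    -- starts from v at time k ends at a value below k, which can only be k - 1.
    module _ (v : Fin (2 * n)) (v<n : toℕ v < n) (placed : ∀ c → toℕ c < toℕ v → Placed c) where

      private
        v̄ : Fin (2 * n)
        v̄ = v ᵒ

        Chain : ℕ → Set
        Chain k = ∀ e → k ≤ toℕ e → toℕ e ≤ toℕ v → Before (W (suc (toℕ e))) v̄ e

        e<v̄ : ∀ {e : Fin (2 * n)} → toℕ e ≤ toℕ v → toℕ e < toℕ v̄
        e<v̄ e≤v = ℕ.≤-<-trans e≤v (v<vᵒ v<n)

        descend : ∀ k → Chain k → ∀ e → Acc _<_ (toℕ e) → toℕ e ≤ toℕ v → toℕ (W k ⁻¹ · e) < n →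
                  Before (W k) v̄ e → ∃ λ c → toℕ c < k × Before (W k) v̄ c
        descend k chain e (acc rec) e≤v half x with toℕ e ℕ.<? k
        ... | yes e<k = e , e<k , x
        ... | no  e≮k with separator k (e<v̄ e≤v) (earlier-≤ (s≤s (ℕ.≮⇒≥ e≮k)) (e<v̄ e≤v) (chain e (ℕ.≮⇒≥ e≮k) e≤v))
        ...   | lower c v̄<c c<e c-half c< = descend k chain c (rec c<) (ℕ.≤-trans (ℕ.<⇒≤ c<) e≤v) c-half v̄<c
        -- A high separator would precede `e`, which is in the first half.
        ...   | upper c v̄<c c<e c-half _  = contradiction (ℕ.<-trans c<e half) (ℕ.≤⇒≯ c-half)

        find : ∀ k → k ≤ toℕ v → Chain k → ∃ λ c → toℕ c < k × Before (W k) v̄ c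
        find k k≤v chain with separator k (v<vᵒ v<n)
               (earlier-≤ (s≤s k≤v) (v<vᵒ v<n) (chain v k≤v ℕ.≤-refl))
        ... | lower c v̄<c c<v half c< = descend k chain c (<-wellFounded _) (ℕ.<⇒≤ c<) half v̄<c
        -- Here `v` may be in the second half, so a high separator is possible. Its mirror `c ᵒ` is
        -- a value below `v` in the first half, preceded by `v̄`, and the descent starts there.
        ... | upper c v̄<c c<v half v̄< = descend k chain (c ᵒ) (<-wellFounded _) (ℕ.<⇒≤ cᵒ<v)
          (subst (λ z → toℕ z < n) (sym (symm (W k ⁻¹) c)) (opposite-≥ half)) (before-ᵒ (W k) c<v)
          where
          cᵒ<v : toℕ (c ᵒ) < toℕ v
          cᵒ<v = subst (λ z → toℕ (c ᵒ) < toℕ z) (ᵒᵒ v) (opposite-anti-< v̄<)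

        noChain : ∀ k → k ≤ toℕ v → ¬ Chain k
        noChain zero    k≤v chain with find zero k≤v chain
        ... | _ , () , _
        noChain (suc k) k<v chain with find (suc k) k<v chain
        ... | c , c≤k , x = noChain k (ℕ.<⇒≤ k<v) chain′
          where
          c≡k : toℕ c ≡ k
          c≡k with toℕ c ℕ.≟ k
          ... | yes eq = eq
          -- A value below `k` is settled by time `suc k`, so `v̄` cannot precede it then.
          ... | no neq = contradiction x (placed c (ℕ.≤-<-trans (s≤s⁻¹ c≤k) k<v) (suc k)
            (s≤s (ℕ.≤∧≢⇒< (s≤s⁻¹ c≤k) neq)) v̄ (e<v̄ (ℕ.≤-trans (s≤s⁻¹ c≤k) (ℕ.<⇒≤ k<v))))
          chain′ : Chain k
          chain′ e k≤e e≤v with toℕ e ℕ.≟ k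
          ... | no neq = chain e (ℕ.≤∧≢⇒< k≤e (neq ∘ sym)) e≤v
          ... | yes e≡k with Fin.toℕ-injective (trans e≡k (sym c≡k))
          ...   | refl = subst (λ z → Before (W (suc z)) v̄ c) (sym c≡k) x

      firstHalf-of-placed : FirstHalf v
      firstHalf-of-placed x = noChain (toℕ v) ℕ.≤-refl λ e v≤e e≤v →
        subst (λ e → Before (W (suc (toℕ e))) v̄ e) (Fin.toℕ-injective (ℕ.≤-antisym v≤e e≤v)) x

      -- A larger `x` before `v` from time `v + 2` on needs a separator at time `v + 1`. A low one
      -- is a smaller value preceded by `x`, although already placed; a high one lies in the second
      -- half before `v`, contradicting `FirstHalf v`.
      placed-of-firstHalf : FirstHalf v → Placed v
      placed-of-firstHalf first t t≥ x v<x b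
        with separator (suc (toℕ v)) v<x (earlier-≤ t≥ v<x b)
      ... | lower c x<c _ _ c<v = placed c c<v (suc (toℕ v)) (s≤s c<v) x (ℕ.<-trans c<v v<x) x<c
      ... | upper c _ c<v half _ = first (ℕ.<-≤-trans
        (subst (λ z → toℕ z < n) (sym (symm (W _ ⁻¹) v)) (opposite-≥ n≤v)) n≤v)
        where
        n≤v : n ≤ toℕ (W (suc (toℕ v)) ⁻¹ · v)
        n≤v = ℕ.≤-trans half (ℕ.<⇒≤ c<v)

    firstHalf-placed : ∀ v → toℕ v < n → FirstHalf v × Placed v
    firstHalf-placed v = go v (<-wellFounded _)
      where
      go : ∀ v → Acc _<_ (toℕ v) → toℕ v < n → FirstHalf v × Placed v
      go v (acc rec) v<n = first , placed-of-firstHalf v v<n placed first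
        where
        placed : ∀ c → toℕ c < toℕ v → Placed c
        placed c c<v = proj₂ (go c (rec c<v) (ℕ.<-trans c<v v<n))
        first : FirstHalf v
        first = firstHalf-of-placed v v<n placed

    -- `Placed` at time `n` excludes every inversion with `a ≤ n - 2` and, by reversal, every one
    -- with `b ≥ n + 1`. The pair `n - 1`, `n` remains; its members are opposite, so `FirstHalf` at
    -- time `n` excludes it.
    sorted : ∀ {a b} → toℕ a < toℕ b → ¬ Before (W n) b a
    sorted {a} {b} a<b x with 2 + toℕ a ℕ.≤? n | 2 + toℕ (b ᵒ) ℕ.≤? n
    ... | yes le | _      = proj₂ (firstHalf-placed a (ℕ.≤-trans (ℕ.n≤1+n _) le)) n le b a<b x
    ... | no _   | yes le = proj₂ (firstHalf-placed (b ᵒ) (ℕ.≤-trans (ℕ.n≤1+n _) le)) n le (a ᵒ)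
      (opposite-anti-< a<b) (before-ᵒ (W n) x)
    ... | no a≮  | no b≮  = proj₁ (firstHalf-placed a (ℕ.≤-reflexive a≡))
      (subst₂ (λ t z → Before (W t) z a) (sym a≡) b≡ x)
      where
      n≤a : n ≤ suc (toℕ a)
      n≤a = s≤s⁻¹ (ℕ.≰⇒> a≮)
      n≤b : n ≤ suc (toℕ (b ᵒ))
      n≤b = s≤s⁻¹ (ℕ.≰⇒> b≮)
      b≤n : toℕ b ≤ n
      b≤n = ℕ.+-cancelˡ-≤ n _ _ (ℕ.≤-trans (ℕ.+-monoˡ-≤ (toℕ b) n≤b)
        (ℕ.≤-reflexive (trans (sym (ℕ.+-suc _ _)) (trans (opposite-sum b) (sym (n+n≡2*n {n}))))))
      a≡ : suc (toℕ a) ≡ n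
      a≡ = ℕ.≤-antisym (ℕ.≤-trans a<b b≤n) n≤a
      b≡ : b ≡ a ᵒ
      b≡ = Fin.toℕ-injective (ℕ.≤-antisym
        (ℕ.≤-trans b≤n (opposite-< (ℕ.≤-reflexive a≡)))
        (ℕ.≤-trans (ℕ.+-cancelʳ-≤ (suc (toℕ a)) _ _ (ℕ.≤-reflexive (trans (opposite-sum a)
          (trans (sym (n+n≡2*n {n})) (cong₂ _+_ (refl {x = n}) (sym a≡))))))
          (ℕ.≤-trans n≤a a<b)))

    sorts : ε ≈ W n
    sorts = sorted⇒ε (W n) sorted

-- Orbits, their cardinality and the lower bound

module _ {n : ℕ} where

  ⁻¹-resp : {v w : B n} → v ≈ w → ∀ a → v ⁻¹ · a ≡ w ⁻¹ · a
  ⁻¹-resp {v} {w} eq a = ·-injective w (trans (trans (sym (eq (v ⁻¹ · a))) (inverseʳ′ v)) (sym (inverseʳ′ w)))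

  before-resp : {v w : B n} → v ≈ w → ∀ {a b} → Before v a b → Before w a b
  before-resp {v} {w} eq = subst₂ (λ x y → toℕ x < toℕ y) (⁻¹-resp {v} {w} eq _) (⁻¹-resp {v} {w} eq _)

  ε⇒sorted : (w : B n) → ε ≈ w → ∀ {a b} → toℕ a < toℕ b → ¬ Before w b a
  ε⇒sorted w eq a<b b<a = ℕ.<-asym a<b (before-resp {w} {ε} (≈-sym {v = ε} {w} eq) b<a)

  module Orbits (f : B n → B n) (f-step : ∀ w → Step w (f w)) (w : B n) where

    W : ℕ → B n
    W = iterate f w

    iterate-step : ∀ w t → Step (iterate f w t) (iterate f w (suc t))
    iterate-step w zero    = f-step w
    iterate-step w (suc t) = iterate-step (f w) t

    open Sorting W (iterate-step w) public using (earlier-≤; sorts)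

    ε-persists : ∀ {s t} → s ≤ t → ε ≈ W s → ε ≈ W t
    ε-persists {s} {t} s≤t eq = sorted⇒ε (W t) λ a<b b<a → ε⇒sorted (W s) eq a<b (earlier-≤ s≤t a<b b<a)

    repeat⇒ε : ∀ {s t} → s < t → W s ≈ W t → ε ≈ W s
    repeat⇒ε {s} {t} s<t eq = Sorting.sorts (λ _ → W s) λ _ → mkStep λ a<b b<a →
      inversion (iterate-step w s) a<b (earlier-≤ s<t a<b (before-resp {W s} {W t} eq b<a))

    sorting-time : ∃ λ t → ε ≈ W t × (∀ j → ε ≈ W j → t ≤ j)
    sorting-time = least (λ t → ε ≈? W t) n sorts

    orbit-cardinality : ∀ t → ε ≈ W t → (∀ j → ε ≈ W j → t ≤ j) → HasCardinality (Orbit f w) (suc t)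
    orbit-cardinality t done first = record
      { to        = to
      ; cong      = λ { refl _ → refl }
      ; bijective = injective , surjective
      }
      where
      to : Fin (suc t) → ∃ λ v → ∃ λ s → v ≈ W s
      to s = W (toℕ s) , toℕ s , λ _ → refl
      distinct : ∀ {i j : Fin (suc t)} → toℕ i < toℕ j → ¬ W (toℕ i) ≈ W (toℕ j)
      distinct {i} {j} i<j eq = ℕ.<⇒≱ (ℕ.<-≤-trans i<j (s≤s⁻¹ (Fin.toℕ<n j))) (first (toℕ i) (repeat⇒ε i<j eq))
      injective : ∀ {i j} → W (toℕ i) ≈ W (toℕ j) → i ≡ j
      injective {i} {j} eq with Fin.<-cmp i j
      ... | tri< i<j _ _ = contradiction eq (distinct i<j)
      ... | tri≈ _ i≡j _ = i≡j
      ... | tri> _ _ j<i = contradiction (≈-sym {v = W (toℕ i)} {W (toℕ j)} eq) (distinct j<i)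
      surjective : (y : ∃ λ v → ∃ λ s → v ≈ W s) → ∃ λ x → ∀ {z} → z ≡ x → W (toℕ z) ≈ proj₁ y
      surjective (v , s , eq) with s ℕ.≤? t
      ... | yes s≤t = fromℕ< (s≤s s≤t) , λ { refl → subst (λ r → W r ≈ v) (sym (Fin.toℕ-fromℕ< (s≤s s≤t)))
                                               (≈-sym {v = v} {W s} eq) }
      ... | no  s≰t = fromℕ< (ℕ.n<1+n t) , λ { refl x → subst (λ r → W r · x ≡ v · x) (sym (Fin.toℕ-fromℕ< (ℕ.n<1+n t)))
              (trans (sym (done x)) (trans (ε-persists (ℕ.<⇒≤ (ℕ.≰⇒> s≰t)) done x) (sym (eq x)))) }

  -- An element with a long orbit

  module LongOrbit (K : Fin (2 * n)) (1+K≡n : suc (toℕ K) ≡ n) where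

    K<n : toℕ K < n
    K<n = ℕ.≤-reflexive 1+K≡n

    Kᵒ≡n : toℕ (K ᵒ) ≡ n
    Kᵒ≡n = ℕ.+-cancelʳ-≡ (suc (toℕ K)) _ _
      (trans (opposite-sum K) (trans (sym (n+n≡2*n {n})) (cong (n +_) (sym 1+K≡n))))

    <n⇒≢Kᵒ : ∀ {x} → toℕ x < n → x ≢ K ᵒ
    <n⇒≢Kᵒ x<n refl = ℕ.<-irrefl Kᵒ≡n x<n

    -- `K` and `K ᵒ` are the middle values `n - 1` and `n`. Steps create no inversions, so this
    -- property passes to all iterates.
    Central : B n → Set
    Central w = ∀ {a b} → toℕ a < toℕ b → Before w b a → b ≡ K ᵒ ⊎ a ≡ K

    Front : ℕ → B n → Set
    Front s w = ∀ x → s ≤ toℕ x → toℕ x < n → Before w (K ᵒ) x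

    module _ (w m : B n) (min : IsMinimalInClass w m) (central : Central w)
             (s : ℕ) (1+s<n : suc s < n) (front : Front s w) where

      private
        s<2n : s < 2 * n
        s<2n = ℕ.<-≤-trans (ℕ.<-trans (ℕ.n<1+n s) 1+s<n) (ℕ.m≤m+n n _)

        -- `S` is the one value that `K ᵒ` may pass in this step. Its position `q` lies in the first
        -- half and serves as the low separator that protects the larger values.
        S i q : Fin (2 * n)
        S = fromℕ< s<2n
        i = w ⁻¹ · (K ᵒ)
        q = w ⁻¹ · S

        S≡s : toℕ S ≡ s
        S≡s = Fin.toℕ-fromℕ< s<2n

        S<K : toℕ S < toℕ K
        S<K = s≤s⁻¹ (subst₂ _<_ (cong suc (sym S≡s)) (sym 1+K≡n) 1+s<n)

        S<n : toℕ S < n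
        S<n = ℕ.<-trans S<K K<n

        after-S : ∀ {x} → toℕ S < toℕ x → x ≢ K ᵒ → toℕ q < toℕ (w ⁻¹ · x)
        after-S {x} S<x x≢ = ℕ.≰⇒> λ x≤q → [ x≢ , Fin.<⇒≢ S<K ]′ (central S<x
          (ℕ.≤∧≢⇒< x≤q λ eq → Fin.<⇒≢ S<x (sym (·-injective (w ⁻¹) (Fin.toℕ-injective eq)))))

        i<q : toℕ i < toℕ q
        i<q = front S (ℕ.≤-reflexive (sym S≡s)) S<n

        iᵒ≡ : w ⁻¹ · K ≡ i ᵒ
        iᵒ≡ = sym (trans (cong opposite (symm (w ⁻¹) K)) (ᵒᵒ _))

        q<iᵒ : toℕ q < toℕ (i ᵒ)
        q<iᵒ = subst (λ z → toℕ q < toℕ z) iᵒ≡ (after-S S<K (<n⇒≢Kᵒ K<n))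

        q<n : toℕ q < n
        q<n = ℕ.≰⇒> λ n≤q → ℕ.<-asym (ℕ.<-≤-trans (opposite-≥ n≤q) n≤q)
          (subst (λ z → toℕ q < toℕ z) (symm (w ⁻¹) S)
            (after-S (ℕ.<-≤-trans S<n (opposite-< S<n)) (Fin.<⇒≢ S<K ∘ opposite-injective)))

        inverted-w : ∀ {y z} → toℕ y < toℕ z → toℕ (w · z) < toℕ (w · y) → y ≡ i ⊎ z ≡ i ᵒ
        inverted-w {y} {z} y<z d with central d
          (subst₂ (λ a b → toℕ a < toℕ b) (sym (inverseˡ′ w)) (sym (inverseˡ′ w)) y<z)
        ... | inj₁ wy≡ = inj₁ (trans (sym (inverseˡ′ w)) (cong (w ⁻¹ ·_) wy≡))
        ... | inj₂ wz≡ = inj₂ (trans (sym (inverseˡ′ w)) (trans (cong (w ⁻¹ ·_) wz≡) iᵒ≡))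

        inverted : ∀ {y z} → toℕ y < toℕ z → toℕ (m · z) < toℕ (m · y) → y ≡ i ⊎ z ≡ i ᵒ
        inverted y<z d = inverted-w y<z (minimal-inversions w m min _ _ y<z d)

        q-low : ∀ {z} → toℕ q < toℕ z → toℕ (w · q) < toℕ (w · z) → toℕ (m · q) < toℕ (m · z)
        q-low q<z d = ·-≮⇒> m (λ lt → ℕ.<-asym d (minimal-inversions w m min _ _ q<z lt)) (Fin.<⇒≢ q<z ∘ sym)

        wq<w : ∀ {x} → toℕ S < toℕ x → toℕ (w · q) < toℕ (w · (w ⁻¹ · x))
        wq<w = subst₂ (λ a b → toℕ a < toℕ b) (sym (inverseʳ′ w)) (sym (inverseʳ′ w))

        mq<miᵒ : toℕ (m · q) < toℕ (m · (i ᵒ))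
        mq<miᵒ = q-low q<iᵒ (subst (λ z → toℕ (w · q) < toℕ (w · z)) iᵒ≡ (wq<w S<K))

      -- Otherwise the value of i in m could be lowered inside the class.
      front-step : Front (suc s) (w ∙ m ⁻¹)
      front-step x s<x x<n = ·-≮⇒> m {j} {i} mj≮mi (Fin.<⇒≢ i<j ∘ sym)
        where
        j : Fin (2 * n)
        j = w ⁻¹ · x
        i<j : toℕ i < toℕ j
        i<j = front x (ℕ.<⇒≤ s<x) x<n
        S<x : toℕ S < toℕ x
        S<x = subst (_< toℕ x) (sym S≡s) s<x
        mq<mj : toℕ (m · q) < toℕ (m · j)
        mq<mj = q-low (after-S S<x (<n⇒≢Kᵒ x<n)) (wq<w S<x)

        mj≮mi : ¬ toℕ (m · j) < toℕ (m · i)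
        mj≮mi mj<mi = absurd (crossing (λ v → toℕ i < toℕ (m ⁻¹ · v)) (λ v → toℕ i ℕ.<? toℕ (m ⁻¹ · v))
          (ℕ.<⇒≤ mj<mi) (subst (λ z → toℕ i < toℕ z) (sym (inverseˡ′ m)) i<j)
          (λ lt → ℕ.<-irrefl (cong toℕ (sym (inverseˡ′ m))) lt))
          where
          mq<mi : toℕ (m · q) < toℕ (m · i)
          mq<mi = ℕ.<-trans mq<mj mj<mi

          absurd : ¬ (∃₂ λ a b → toℕ b ≡ suc (toℕ a) × toℕ (m · j) ≤ toℕ a × toℕ b ≤ toℕ (m · i) ×
                        toℕ i < toℕ (m ⁻¹ · a) × ¬ toℕ i < toℕ (m ⁻¹ · b))
          absurd (a , b , b≡1+a , mj≤a , b≤mi , i<u , i≮p) = Swap.notMinimal m i<u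
            (subst (λ z → toℕ (m · z) ≡ suc (toℕ (m · u))) p≡i mp≡1+mu) sep gain gainᵒ w min
            where
            p u : Fin (2 * n)
            p = m ⁻¹ · b
            u = m ⁻¹ · a
            mp≡1+mu : toℕ (m · p) ≡ suc (toℕ (m · u))
            mp≡1+mu = subst₂ (λ y z → toℕ y ≡ suc (toℕ z)) (sym (inverseʳ′ m)) (sym (inverseʳ′ m)) b≡1+a
            mq<mu : toℕ (m · q) < toℕ (m · u)
            mq<mu = subst (λ z → toℕ (m · q) < toℕ z) (sym (inverseʳ′ m)) (ℕ.<-≤-trans mq<mj mj≤a)
            p≤i : toℕ p ≤ toℕ i
            p≤i = ℕ.≮⇒≥ i≮p
            p<u : toℕ p < toℕ u
            p<u = ℕ.≤-<-trans p≤i i<u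
            mu<mp : toℕ (m · u) < toℕ (m · p)
            mu<mp = ℕ.≤-reflexive (sym mp≡1+mu)

            -- If `p < i`, the inversion of `p` and `u` in `m` forces `u ≡ i ᵒ`, the position of `K`
            -- in `w`. Then `w · p` exceeds `K`, hence also `w · i`, and `p`, `i` form an inversion
            -- of `w` that `Central` forbids.
            p≡i : p ≡ i
            p≡i = decidable-stable (p Fin.≟ i) λ p≢i →
              let p<i = ℕ.≤∧≢⇒< p≤i (p≢i ∘ Fin.toℕ-injective)
                  u≡iᵒ = [ (λ e → contradiction e p≢i) , (λ e → e) ]′ (inverted p<u mu<mp)
                  K<wp = subst (λ z → toℕ z < toℕ (w · p))
                           (trans (cong (w ·_) (trans u≡iᵒ (sym iᵒ≡))) (inverseʳ′ w))
                           (minimal-inversions w m min _ _ p<u mu<mp)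
                  wi≤wp = subst (_≤ toℕ (w · p))
                           (trans 1+K≡n (trans (sym Kᵒ≡n) (cong toℕ (sym (inverseʳ′ w))))) K<wp
                  wi<wp = ℕ.≤∧≢⇒< wi≤wp (p≢i ∘ sym ∘ ·-injective w ∘ Fin.toℕ-injective)
              in [ p≢i , Fin.<⇒≢ (ℕ.<-trans i<q q<iᵒ) ]′ (inverted-w p<i wi<wp)

            q<u : toℕ q < toℕ u
            q<u = ℕ.≰⇒> λ u≤q → [ (λ e → Fin.<⇒≢ i<u (sym e)) , Fin.<⇒≢ q<iᵒ ]′
              (inverted (ℕ.≤∧≢⇒< u≤q λ e → ℕ.<-irrefl (cong (λ z → toℕ (m · z)) (sym (Fin.toℕ-injective e))) mq<mu) mq<mu)

            sep : Separated m i u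
            sep = separated-low m (low i<q q<u q<n mq<mi mq<mu)

            -- Vacuous: such a `y` would give an inversion of `m` ending at `i`, which `inverted`
            -- excludes.
            gain : ∀ y → toℕ y < toℕ i → toℕ i < n → toℕ (m · i) < toℕ (m · y) → Separated m y u
            gain y y<i _ d = contradiction (inverted y<i d) [ Fin.<⇒≢ y<i , Fin.<⇒≢ (ℕ.<-trans i<q q<iᵒ) ]′

            -- The only such `y` is `i`, and `q` separates it from `i ᵒ` too.
            gainᵒ : ∀ y → toℕ y < toℕ (u ᵒ) → toℕ (u ᵒ) < n → toℕ (m · (u ᵒ)) < toℕ (m · y) → Separated m y (i ᵒ)
            gainᵒ y y<uᵒ _ d with inverted y<uᵒ d
            ... | inj₁ refl = separated-low m (low i<q q<iᵒ q<n mq<mi mq<miᵒ)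
            ... | inj₂ e    = contradiction (sym (opposite-injective e)) (Fin.<⇒≢ i<u)

    module _ (f : B n → B n) (f-step : ∀ w → Step w (f w))
             (f-front : ∀ w s → Central w → suc s < n → Front s w → Front (suc s) (f w)) where

      front-iterate : ∀ t s w → Central w → Front s w → t + s < n → Front (t + s) (iterate f w t)
      front-iterate zero    s w central front _  = front
      front-iterate (suc t) s w central front lt =
        subst (λ r → Front r (iterate f (f w) t)) (ℕ.+-suc t s)
          (front-iterate t (suc s) (f w) (λ a<b b<a → central a<b (proj₁ (inversion (f-step w) a<b b<a)))
            (f-front w s central (ℕ.≤-<-trans (s≤s (ℕ.m≤n+m s t)) lt) front)
            (subst (_< n) (sym (ℕ.+-suc t s)) lt))

      sorting-time-≥ : (w : B n) → Central w → Front 0 w → ∀ t → ε ≈ iterate f w t → n ≤ t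
      -- If `t < n`, then `t ≤ K`. At time `K` the value `n` still precedes `n - 1`, and it must
      -- then do so at time `t` as well.
      sorting-time-≥ w central front t eq = ℕ.≮⇒≥ λ t<n → ε⇒sorted (W t) eq K<Kᵒ
        (earlier-≤ (s≤s⁻¹ (subst (t <_) (sym 1+K≡n) t<n)) K<Kᵒ
          (subst (λ r → Front r (W (toℕ K))) (ℕ.+-identityʳ _)
            (front-iterate (toℕ K) 0 w central front (subst (_< n) (sym (ℕ.+-identityʳ _)) K<n)) K ℕ.≤-refl K<n))
        where
        open Orbits f f-step w
        K<Kᵒ : toℕ K < toℕ (K ᵒ)
        K<Kᵒ = ℕ.<-≤-trans K<n (opposite-< K<n)

      long-orbit : (w : B n) → Central w → Front 0 w → HasCardinality (Orbit f w) (suc n)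
      long-orbit w central front = let t , done , first = Orbits.sorting-time f f-step w in
        subst (λ r → HasCardinality (Orbit f w) (suc r))
          (ℕ.≤-antisym (first n (Orbits.sorts f f-step w)) (sorting-time-≥ w central front t done))
          (Orbits.orbit-cardinality f f-step w t done first)

    sᴮ-front : ∀ w s → Central w → suc s < n → Front s w → Front (suc s) (sᴮ w)
    sᴮ-front w s central 1+s<n front =
      front-step w (π↓ w) (proj₂ (minimalInClass w)) central s 1+s<n front

-- Construction of the element with the long orbit

module OddExtension (n : ℕ) where

  -- The symmetry condition of `B` determines a map from its first half; `h` is consulted only
  -- there.
  odd : (Fin (2 * n) → Fin (2 * n)) → Fin (2 * n) → Fin (2 * n)
  odd h x with toℕ x ℕ.<? n
  ... | yes _ = h x
  ... | no  _ = h (x ᵒ) ᵒ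

  module _ (h : Fin (2 * n) → Fin (2 * n)) where

    odd-< : ∀ {x} → toℕ x < n → odd h x ≡ h x
    odd-< {x} x<n with toℕ x ℕ.<? n
    ... | yes _  = refl
    ... | no x≮n = contradiction x<n x≮n

    odd-≥ : ∀ {x} → n ≤ toℕ x → odd h x ≡ h (x ᵒ) ᵒ
    odd-≥ {x} n≤x with toℕ x ℕ.<? n
    ... | yes x<n = contradiction n≤x (ℕ.<⇒≱ x<n)
    ... | no _    = refl

    odd-ᵒ : ∀ x → odd h (x ᵒ) ≡ odd h x ᵒ
    odd-ᵒ x with toℕ x ℕ.<? n
    ... | yes x<n = trans (odd-≥ (opposite-< x<n)) (cong (λ z → h z ᵒ) (ᵒᵒ x))
    ... | no  x≮n = trans (odd-< (opposite-≥ (ℕ.≮⇒≥ x≮n))) (sym (ᵒᵒ _))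

  odd-inverse : ∀ g h → (∀ x → toℕ x < n → odd g (odd h x) ≡ x) → ∀ x → odd g (odd h x) ≡ x
  odd-inverse g h inv x with toℕ x ℕ.<? n
  ... | yes x<n = trans (cong (odd g) (sym (odd-< h x<n))) (inv x x<n)
  ... | no  x≮n = trans (odd-ᵒ g (h (x ᵒ)))
    (trans (cong opposite (trans (cong (odd g) (sym (odd-< h xᵒ<n))) (inv (x ᵒ) xᵒ<n))) (ᵒᵒ x))
    where
    xᵒ<n : toℕ (x ᵒ) < n
    xᵒ<n = opposite-≥ (ℕ.≮⇒≥ x≮n)

-- The Coxeter element with one-line notation n, 0, 1, …, n-2 | n+1, …, 2n-1, n-1.
module CoxeterElement (k : ℕ) where

  n : ℕ
  n = suc k

  K : Fin (2 * n)
  K = fromℕ< {k} (s≤s (ℕ.m≤m+n k _))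

  1+K≡n : suc (toℕ K) ≡ n
  1+K≡n = cong suc (Fin.toℕ-fromℕ< {k} (s≤s (ℕ.m≤m+n k _)))

  open OddExtension n
  open LongOrbit K 1+K≡n public using (K<n; Central; Front; <n⇒≢Kᵒ)

  <n-cases : ∀ {x : Fin (2 * n)} → toℕ x < n → x ≡ K ⊎ suc (toℕ x) < n
  <n-cases {x} x<n with suc (toℕ x) ℕ.<? n
  ... | yes lt = inj₂ lt
  ... | no ≮   = inj₁ (Fin.toℕ-injective (ℕ.suc-injective (trans (ℕ.≤-antisym x<n (ℕ.≮⇒≥ ≮)) (sym 1+K≡n))))

  value position : Fin (2 * n) → Fin (2 * n)
  value zero    = opposite K
  value (suc p) = inject₁ p
  position v with suc (toℕ v) ℕ.<? n
  ... | yes lt = fromℕ< (ℕ.<-≤-trans lt (ℕ.m≤m+n n (n + 0)))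
  -- Within the first half this clause is reached only by `v ≡ K`, whose position is the last one.
  ... | no _   = opposite zero

  position-suc : ∀ {v} → suc (toℕ v) < n → toℕ (odd position v) ≡ suc (toℕ v)
  position-suc {v} lt = trans (cong toℕ (odd-< position (ℕ.<-trans (ℕ.n<1+n (toℕ v)) lt))) position≡
    where
    position≡ : toℕ (position v) ≡ suc (toℕ v)
    position≡ with suc (toℕ v) ℕ.<? n
    ... | yes lt′ = Fin.toℕ-fromℕ< (ℕ.<-≤-trans lt′ (ℕ.m≤m+n n (n + 0)))
    ... | no ≮    = contradiction lt ≮

  position-K : odd position K ≡ opposite zero
  position-K = trans (odd-< position K<n) position≡
    where
    position≡ : position K ≡ opposite zero
    position≡ with suc (toℕ K) ℕ.<? n
    ... | yes lt = contradiction 1+K≡n (ℕ.<⇒≢ lt)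
    ... | no _   = refl

  position-Kᵒ : odd position (opposite K) ≡ zero
  position-Kᵒ = trans (odd-ᵒ position K) (trans (cong opposite position-K) (Fin.opposite-involutive _))

  value-suc : ∀ {p v} → toℕ p ≡ suc v → toℕ (value p) ≡ v
  value-suc {suc p} eq = trans (Fin.toℕ-inject₁ p) (ℕ.suc-injective eq)

  value-position : ∀ v → odd value (odd position v) ≡ v
  value-position = odd-inverse value position λ v v<n → go v (<n-cases v<n)
    where
    go : ∀ v → v ≡ K ⊎ suc (toℕ v) < n → odd value (odd position v) ≡ v
    go v (inj₁ refl) = trans (cong (odd value) position-K) (trans (odd-ᵒ value zero)
      (trans (cong opposite (odd-< value (s≤s z≤n))) (Fin.opposite-involutive K)))
    go v (inj₂ lt) = trans (odd-< value (subst (_< n) (sym (position-suc lt)) lt))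
      (Fin.toℕ-injective (value-suc (position-suc lt)))

  position-value : ∀ p → odd position (odd value p) ≡ p
  position-value = odd-inverse position value go
    where
    go : ∀ p → toℕ p < n → odd position (odd value p) ≡ p
    go zero    p<n = trans (cong (odd position) (odd-< value p<n)) position-Kᵒ
    go (suc p) p<n = trans (cong (odd position) (odd-< value p<n)) (Fin.toℕ-injective
      (trans (position-suc (subst (λ z → suc z < n) (sym (Fin.toℕ-inject₁ p)) p<n)) (cong suc (Fin.toℕ-inject₁ p))))

  coxeter : B n
  coxeter = mkB (permutation (odd value) (odd position) value-position position-value) (odd-ᵒ value)

  position≤last : ∀ x → toℕ (odd position x) ≤ toℕ (opposite {2 * n} zero)
  position≤last x = subst (toℕ (odd position x) ≤_) (sym (Fin.opposite-prop {2 * n} zero)) (s≤s⁻¹ (Fin.toℕ<n (odd position x)))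

  position-<n : ∀ {a} → toℕ a < n → a ≢ K → toℕ (odd position a) < n
  position-<n a<n a≢K with <n-cases a<n
  ... | inj₁ a≡K = contradiction a≡K a≢K
  ... | inj₂ lt  = subst (_< n) (sym (position-suc lt)) lt

  position-mono : ∀ {a b} → toℕ a < toℕ b → toℕ b < n → toℕ (odd position a) ≤ toℕ (odd position b)
  position-mono {a} {b} a<b b<n with <n-cases b<n
  ... | inj₁ refl = subst (λ z → toℕ (odd position a) ≤ toℕ z) (sym position-K) (position≤last a)
  ... | inj₂ lt   = subst₂ _≤_ (sym (position-suc (ℕ.<-trans (s≤s a<b) lt))) (sym (position-suc lt)) (ℕ.<⇒≤ (s≤s a<b))

  -- With the values `n` and `n - 1` left out, the one-line notation is increasing: within the first
  -- half by `position-mono`, within the second by reversal, and across the halves because each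
  -- remaining value stays in its own half.
  central : Central coxeter
  central {a} {b} a<b b<a with b Fin.≟ opposite K | a Fin.≟ K
  ... | yes b≡ | _      = inj₁ b≡
  ... | no _   | yes a≡ = inj₂ a≡
  ... | no b≢  | no a≢  = contradiction b<a (ℕ.≤⇒≯ (ordered (toℕ a ℕ.<? n) (toℕ b ℕ.<? n)))
    where
    bᵒ≢ : opposite b ≢ K
    bᵒ≢ e = b≢ (trans (sym (Fin.opposite-involutive b)) (cong opposite e))
    ordered : Dec (toℕ a < n) → Dec (toℕ b < n) → toℕ (odd position a) ≤ toℕ (odd position b)
    ordered _         (yes b<n) = position-mono a<b b<n
    ordered (yes a<n) (no b≮n)  = ℕ.≤-trans (ℕ.<⇒≤ (position-<n a<n a≢))
      (subst (λ z → n ≤ toℕ z) (trans (cong opposite (odd-ᵒ position b)) (Fin.opposite-involutive _))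
        (opposite-< (position-<n (opposite-≥ (ℕ.≮⇒≥ b≮n)) bᵒ≢)))
    ordered (no a≮n)  (no b≮n)  = opposite-cancel-≤ (subst₂ (λ y z → toℕ y ≤ toℕ z)
      (odd-ᵒ position b) (odd-ᵒ position a)
      (position-mono (opposite-anti-< a<b) (opposite-≥ (ℕ.≮⇒≥ a≮n))))

  front : Front 0 coxeter
  front x _ x<n = subst (λ z → toℕ z < toℕ (odd position x)) (sym position-Kᵒ)
    (ℕ.n≢0⇒n>0 λ eq → <n⇒≢Kᵒ x<n (·-injective (coxeter ⁻¹) (trans (Fin.toℕ-injective eq) (sym position-Kᵒ))))

theorem7p2 : (n : ℕ) → 1 ≤ n →
    ((w : B n) → ∃ λ k → HasCardinality (Orbit sᴮ w) k × k ≤ n + 1) ×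
    (∃ λ (w : B n) → HasCardinality (Orbit sᴮ w) (n + 1))
theorem7p2 n@(suc k) _ = bounded , coxeter , longest
  where
  open CoxeterElement k using (K; 1+K≡n; coxeter; central; front)
  open Orbits sᴮ sᴮ-step using (sorting-time; sorts; orbit-cardinality)
  bounded : (w : B n) → ∃ λ k → HasCardinality (Orbit sᴮ w) k × k ≤ n + 1
  bounded w = let t , done , first = sorting-time w in
    suc t , orbit-cardinality w t done first ,
    ℕ.≤-trans (s≤s (first n (sorts w))) (ℕ.≤-reflexive (ℕ.+-comm 1 n))
  longest : HasCardinality (Orbit sᴮ coxeter) (n + 1)
  longest = subst (HasCardinality (Orbit sᴮ coxeter)) (ℕ.+-comm 1 n)
    (LongOrbit.long-orbit K 1+K≡n sᴮ sᴮ-step (LongOrbit.sᴮ-front K 1+K≡n) coxeter central front)
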